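{- For each $i=0,1$ let $G_i$ be a triangle-free $k$-regular super-$\lambda$ graph of order $n$, and let $\lambda'_i=\lambda'(G_i)$. Let $M$ be an arbitrary perfect matching between the vertices of $G_0$ and the vertices of $G_1$. If $\min\{n,\lambda'_0+\lambda'_1\}>3k-1$, then $G=G(G_0,G_1;M)$ is super-$\lambda''$ and $\rho'(G)=k$.
   Context: All graphs are finite and simple. For two graphs $G_0,G_1$ with the same number of vertices (on disjoint vertex-sets) and a perfect matching $M$ between $V(G_0)$ and $V(G_1)$ (i.e. the edges of $M$ realize a bijection $V(G_0)\to V(G_1)$), $G(G_0,G_1;M)$ is the graph with vertex-set $V(G_0)\cup V(G_1)$ and edge-set $E(G_0)\cup E(G_1)\cup M$. For a connected graph $G=(V,E)$ and an integer $h\geqslant 0$, a set $F\subseteq E(G)$ is an $h$-extra edge-cut if $G-F$ is disconnected and every component of $G-F$ has more than $h$ vertices. If such a set exists, $\lambda^{(h)}(G)$ is the minimum cardinality of an $h$-extra edge-cut, and $G$ is called $\lambda^{(h)}$-connected. A $\lambda^{(h)}$-cut is an $h$-extra edge-cut of cardinality $\lambda^{(h)}(G)$. Write $\lambda=\lambda^{(0)}$ (the edge-connectivity), $\lambda'=\lambda^{(1)}$ and $\lambda''=\lambda^{(2)}$. For $X\subset V(G)$, $d_G(X)$ is the number of edges between $X$ and $V(G)\setminus X$, and $\xi_h(G)=\min\{d_G(X): X\subset V(G),\ |X|=h+1,\ G[X]\text{ connected}\}$. A $\lambda^{(h)}$-connected graph $G$ is $\lambda^{(h)}$-optimal if $\lambda^{(h)}(G)=\xi_h(G)$,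 and it is super-$\lambda^{(h)}$ if it is $\lambda^{(h)}$-optimal and, for every $\lambda^{(h)}$-cut $F$ of $G$, some component of $G-F$ has exactly $h+1$ vertices. Super-$\lambda$, super-$\lambda'$ and super-$\lambda''$ are the cases $h=0,1,2$. A disconnected graph is not super-$\lambda^{(h)}$. For a super-$\lambda'$ graph $G$, the persistence $\rho'(G)$ is the maximum integer $m$ such that $G-F$ is still super-$\lambda'$ for every $F\subseteq E(G)$ with $|F|\leqslant m$. Any assertion about $\rho'(G)$ includes the assertion that $G$ is super-$\lambda'$. -}

module Defs where

open import Algebra.Properties.CommutativeMonoid.Sum using (sum)
open import Data.Bool using (Bool; false; T; not; _∧_; _xor_)
open import Data.Bool.Properties using (∧-zeroʳ; xor-comm; xor-same)
open import Data.Fin using (Fin; splitAt; _<?_)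
open import Data.Fin.Properties using (_≟_)
open import Data.Fin.Permutation using (Permutation; _⟨$⟩ʳ_)
open import Data.Fin.Subset using (Subset; _∈_; _⊂_; ⊤; ∣_∣)
open import Data.Nat using (ℕ; suc; _+_; _≤_; _<_)
open import Data.Nat.Properties using (+-0-commutativeMonoid)
open import Data.Product using (∃; _×_)
open import Data.Sum using (_⊎_; inj₁; inj₂)
open import Data.Vec using (lookup; tabulate)
open import Function using (_⇔_)
open import Relation.Binary.Construct.Closure.ReflexiveTransitive using (Star)
open import Relation.Binary.PropositionalEquality
  using (_≡_; refl; trans; cong; cong₂)
open import Relation.Nullary using (¬_; does)

private
  variable
    n : ℕ

-- A finite simple graph with vertex set Fin n. Since the vertex set is
-- fixed, the same type also represents sets of edges: a set F ⊆ E(G) is a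
-- graph F on the same vertices with F ⊆ᴱ G.
record Graph (n : ℕ) : Set where
  field
    adj      : Fin n → Fin n → Bool
    adj-sym  : ∀ u v → adj u v ≡ adj v u
    adj-irr  : ∀ u → adj u u ≡ false

  Adj : Fin n → Fin n → Set
  Adj u v = T (adj u v)

open Graph public

infix 4 _⊆ᴱ_
_⊆ᴱ_ : Graph n → Graph n → Set
F ⊆ᴱ G = ∀ u v → Adj F u v → Adj G u v

-- The number of edges; each edge uv is counted once, at its smaller end.
size : Graph n → ℕ
size G = sum +-0-commutativeMonoid
  (λ u → ∣ tabulate (λ v → does (u <? v) ∧ adj G u v) ∣)

infixl 6 _∖_
_∖_ : Graph n → Graph n → Graph n
G ∖ F = record
  { adj     = λ u v → adj G u v ∧ not (adj F u v)
  ; adj-sym = λ u v → cong₂ (λ a b → a ∧ not b) (adj-sym G u v) (adj-sym F u v)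
  ; adj-irr = λ u → cong (_∧ not (adj F u u)) (adj-irr G u)
  }

degree : Graph n → Fin n → ℕ
degree G u = ∣ tabulate (adj G u) ∣

Regular : ℕ → Graph n → Set
Regular k G = ∀ u → degree G u ≡ k

TriangleFree : Graph n → Set
TriangleFree G = ∀ u v w → Adj G u v → Adj G v w → ¬ Adj G w u

Reachable : Graph n → Fin n → Fin n → Set
Reachable G = Star (Adj G)

Connected : Graph n → Set
Connected G = ∀ u v → Reachable G u v

-- C is the vertex set of a connected component of G.
IsComponent : Graph n → Subset n → Set
IsComponent G C = ∃ λ u → ∀ v → (v ∈ C) ⇔ Reachable G u v

-- G[X] is connected: any two vertices of X are joined by a path inside X.
InducesConnected : Graph n → Subset n → Set
InducesConnected G X = ∀ u v → u ∈ X → v ∈ X →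
  Star (λ x y → x ∈ X × y ∈ X × Adj G x y) u v

-- The edges of G with exactly one end in X.
boundary : Graph n → Subset n → Graph n
boundary G X = record
  { adj     = λ u v → adj G u v ∧ (lookup X u xor lookup X v)
  ; adj-sym = λ u v → cong₂ _∧_ (adj-sym G u v) (xor-comm (lookup X u) (lookup X v))
  ; adj-irr = λ u → trans (cong (adj G u u ∧_) (xor-same (lookup X u))) (∧-zeroʳ (adj G u u))
  }

d : Graph n → Subset n → ℕ
d G X = size (boundary G X)

-- m is the minimum of f over the elements satisfying P; in particular some
-- element satisfies P.
IsMinimum : {A : Set} → (A → Set) → (A → ℕ) → ℕ → Set
IsMinimum P f m = (∃ λ x → P x × f x ≡ m) × (∀ x → P x → m ≤ f x)

IsExtraEdgeCut : ℕ → Graph n → Graph n → Set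
IsExtraEdgeCut h G F =
  F ⊆ᴱ G × ¬ Connected (G ∖ F) × (∀ C → IsComponent (G ∖ F) C → h < ∣ C ∣)

-- "G is connected, λ⁽ʰ⁾(G) is defined, and it equals m". The invariants
-- λ⁽ʰ⁾, ξₕ and ρ′ need not exist, so they are given as relations between a
-- graph and a value, of which there is at most one.
IsExtraEdgeConnectivity : ℕ → Graph n → ℕ → Set
IsExtraEdgeConnectivity h G m =
  Connected G × IsMinimum (IsExtraEdgeCut h G) size m

-- F is a λ⁽ʰ⁾-cut of G.
IsMinExtraEdgeCut : ℕ → Graph n → Graph n → Set
IsMinExtraEdgeCut h G F =
  IsExtraEdgeCut h G F × IsExtraEdgeConnectivity h G (size F)

-- ξₕ(G) = m.
IsMinEdgeDegree : ℕ → Graph n → ℕ → Set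
IsMinEdgeDegree h G =
  IsMinimum (λ X → X ⊂ ⊤ × ∣ X ∣ ≡ suc h × InducesConnected G X) (d G)

-- λ⁽ʰ⁾-optimality; being λ⁽ʰ⁾-connected is part of the first component.
Optimal : ℕ → Graph n → Set
Optimal h G = ∃ λ m → IsExtraEdgeConnectivity h G m × IsMinEdgeDegree h G m

-- Super-λ⁽ʰ⁾; super-λ, super-λ′ and super-λ″ are the cases h = 0, 1, 2.
Super : ℕ → Graph n → Set
Super h G = Optimal h G ×
  (∀ F → IsMinExtraEdgeCut h G F →
    ∃ λ C → IsComponent (G ∖ F) C × ∣ C ∣ ≡ suc h)

Persists : Graph n → ℕ → Set
Persists G m = ∀ F → F ⊆ᴱ G → size F ≤ m → Super 1 (G ∖ F)

-- G is super-λ′ and ρ′(G) = m.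
IsPersistence : Graph n → ℕ → Set
IsPersistence G m = Super 1 G × Persists G m × (∀ m′ → Persists G m′ → m′ ≤ m)

-- G(G₀,G₁;M). In Fin (n + n) the first n vertices form V(G₀) and the last n
-- form V(G₁); the matching M joins u ∈ V(G₀) to M ⟨$⟩ʳ u ∈ V(G₁).
matchingAdj : Graph n → Graph n → Permutation n n →
              Fin n ⊎ Fin n → Fin n ⊎ Fin n → Bool
matchingAdj G₀ G₁ M (inj₁ u) (inj₁ v) = adj G₀ u v
matchingAdj G₀ G₁ M (inj₁ u) (inj₂ v) = does (M ⟨$⟩ʳ u ≟ v)
matchingAdj G₀ G₁ M (inj₂ u) (inj₁ v) = does (M ⟨$⟩ʳ v ≟ u)
matchingAdj G₀ G₁ M (inj₂ u) (inj₂ v) = adj G₁ u v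

matchingAdj-sym : ∀ (G₀ G₁ : Graph n) M x y →
                  matchingAdj G₀ G₁ M x y ≡ matchingAdj G₀ G₁ M y x
matchingAdj-sym G₀ G₁ M (inj₁ u) (inj₁ v) = adj-sym G₀ u v
matchingAdj-sym G₀ G₁ M (inj₁ u) (inj₂ v) = refl
matchingAdj-sym G₀ G₁ M (inj₂ u) (inj₁ v) = refl
matchingAdj-sym G₀ G₁ M (inj₂ u) (inj₂ v) = adj-sym G₁ u v

matchingAdj-irr : ∀ (G₀ G₁ : Graph n) M x → matchingAdj G₀ G₁ M x x ≡ false
matchingAdj-irr G₀ G₁ M (inj₁ u) = adj-irr G₀ u
matchingAdj-irr G₀ G₁ M (inj₂ u) = adj-irr G₁ u

matchingGraph : Graph n → Graph n → Permutation n n → Graph (n + n)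
matchingGraph {n} G₀ G₁ M = record
  { adj     = λ x y → matchingAdj G₀ G₁ M (splitAt n x) (splitAt n y)
  ; adj-sym = λ x y → matchingAdj-sym G₀ G₁ M (splitAt n x) (splitAt n y)
  ; adj-irr = λ x → matchingAdj-irr G₀ G₁ M (splitAt n x)
  }

{-# OPTIONS --safe #-}
module Submission where

-- Split X ⊆ V(G) as X₀ ∪ X₁ with X_i ⊆ V(G_i), and write d_i for the boundary
-- of X_i in G_i; the matching contributes at least ||X₀| − |X₁|| further boundary edges.
-- In G_i every proper nonempty set has d_i ≥ k, and d_i ≥ λ′_i as soon as both X_i and its
-- complement have two vertices: otherwise the boundary is no 1-extra cut, some vertex v has
-- no neighbour on its own side, and moving v across gives d_i ≥ k + k > λ′_i. Since
-- λ′_i ≤ 2k − 2, the hypothesis forces k ≥ 4 and λ′_i ≥ k + 2, and with Mantel's bound for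
-- small X_i one gets d(X) ≥ 3k whenever |X| and |V(G) \ X| are at least 4, and
-- d(X) ≥ k + 1 for proper nonempty X. Triangle-freeness gives d(X) ≥ 3k − 1 for |X| = 3, with
-- equality for paths; this is super-λ″.
--
-- For the persistence let H = G − F with |F| ≤ k, and let f be the degree in F. An edge xy
-- of H has edge-degree 2k − f(x) − f(y) in H. A cut of H with all components of order at
-- least 3 is, together with F, a 2-extra cut of G, and comparing it with the minimum
-- edge-degree of H shows that it has more edges than that.

open import Defs
open import Data.Bool using (Bool; true; false; T; not; _∧_; _∨_; _xor_) renaming (_≟_ to _≟ᵇ_)
open import Data.Bool.Properties using (T-≡; not-involutive; ∨-comm; ∧-zeroʳ)
open import Data.Fin using (Fin; zero; suc; _<?_; splitAt; _↑ˡ_; _↑ʳ_)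
open import Data.Fin.Properties using (_≟_; any?; <-cmp; splitAt-↑ˡ; splitAt-↑ʳ; splitAt⁻¹-↑ˡ; splitAt⁻¹-↑ʳ; ¬∀⟶∃¬)
open import Data.Fin.Permutation using (Permutation; _⟨$⟩ʳ_; _⟨$⟩ˡ_; inverseˡ; inverseʳ) renaming (flip to inverse)
open import Data.Fin.Subset using (Subset; _∈_; _⊂_; ∣_∣; ⊤)
open import Data.Fin.Subset.Properties using (∈⊤)
open import Data.Nat using (ℕ; zero; suc; _+_; _*_; _≤_; _<_; _⊓_; z≤n; s≤s)
open import Data.Nat.Properties hiding (<-cmp) renaming (_≟_ to _≟ℕ_; _<?_ to _<?ℕ_)
open import Data.Nat.Tactic.RingSolver using (solve-∀)
open import Data.Product using (∃; _×_; _,_; proj₁; proj₂; ∃₂)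
open import Data.Sum using (_⊎_; inj₁; inj₂; [_,_]′)
open import Data.Vec using (lookup; tabulate)
open import Data.Vec.Properties using (lookup∘tabulate; tabulate∘lookup; []=⇒lookup; lookup⇒[]=)
open import Function using (_∘_; _⇔_; mk⇔; Equivalence)
open import Relation.Binary.Construct.Closure.ReflexiveTransitive using (Star; ε; _◅_; _◅◅_; gmap; reverse)
open import Relation.Binary.Definitions using (tri<; tri≈; tri>)
open import Relation.Binary.PropositionalEquality
open import Relation.Nullary using (¬_; yes; no; does; contradiction)
open import Relation.Nullary.Decidable using (dec-true; dec-false; ¬?; _×-dec_; T?; decidable-stable)
open import Algebra.Properties.CommutativeMonoid.Sum +-0-commutativeMonoid
  using (sum; sum-cong-≗; ∑-distrib-+; ∑-comm; sum-permute; sum-replicate-zero)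

private
  variable
    n : ℕ

-- The margin is a single edge. The critical sets lie almost entirely in one copy, where only one of
-- the two λ′-bounds is available. With b vertices there, Mantel's bound and the matching edges
-- together give a concave quadratic in b, so only the ends of a range need checking; beyond that
-- range b is so large that the matching edges suffice.
--
-- After k deletions the bound 3k shrinks to 2k, which an untouched edge of H attains as its
-- edge-degree. The missing edge comes from the deletions themselves: if m is the minimum
-- edge-degree, then m + f(x) + f(y) ≤ 2k for every edge xy of H, so a deleted edge meeting an edge
-- of H pushes m below 2k. The minimum edge must also provide the 1-extra cut that H is required to
-- have, and its minimality is what prevents a vertex from being left hanging on it. None of this
-- refers to the two copies, hence the interface `Robust`. Since G is (k + 1)-regular, k + 1
-- deletions can isolate a vertex.

≡true : ∀ {b} → T b → b ≡ true
≡true = Equivalence.to T-≡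

fromTrue : ∀ {b} → b ≡ true → T b
fromTrue = Equivalence.from T-≡

≡false : ∀ {b} → ¬ T b → b ≡ false
≡false {false} _ = refl
≡false {true}  f = contradiction _ f

true≢false : ∀ {b} → b ≡ true → b ≢ false
true≢false refl ()

≢false : ∀ {b} → b ≢ false → b ≡ true
≢false {true}  _ = refl
≢false {false} f = contradiction refl f

not-false : ∀ {b} → b ≡ false → not b ≡ true
not-false refl = refl

not-true : ∀ {b} → not b ≡ true → b ≡ false
not-true {false} _ = refl

∧-true : ∀ {a b} → a ∧ b ≡ true → a ≡ true × b ≡ true
∧-true {true} e = refl , e

-- Finite sums and counting

sum-mono : {f g : Fin n → ℕ} → (∀ i → f i ≤ g i) → sum f ≤ sum g
sum-mono {n = zero}  _ = z≤n
sum-mono {n = suc n} h = +-mono-≤ (h zero) (sum-mono (h ∘ suc))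

sum-const : ∀ n c → sum {n} (λ _ → c) ≡ n * c
sum-const zero    c = refl
sum-const (suc n) c = cong (c +_) (sum-const n c)

sum-*ʳ : (f : Fin n → ℕ) (c : ℕ) → sum (λ i → f i * c) ≡ sum f * c
sum-*ʳ {n = zero}  f c = refl
sum-*ʳ {n = suc n} f c =
  trans (cong (f zero * c +_) (sum-*ʳ (f ∘ suc) c)) (sym (*-distribʳ-+ c (f zero) _))

sum-tight : {f g : Fin n → ℕ} → (∀ i → f i ≤ g i) → sum g ≤ sum f → ∀ i → g i ≤ f i
sum-tight {n = suc n} {f} {g} h s zero =
  +-cancelʳ-≤ (sum (g ∘ suc)) (g zero) (f zero)
    (≤-trans s (+-monoʳ-≤ (f zero) (sum-mono (h ∘ suc))))
sum-tight {n = suc n} {f} {g} h s (suc i) =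
  sum-tight (h ∘ suc)
    (+-cancelˡ-≤ (g zero) _ _ (≤-trans s (+-monoˡ-≤ _ (h zero)))) i

sum-positive : (f : Fin n → ℕ) → 1 ≤ sum f → ∃ λ i → 1 ≤ f i
sum-positive {n = suc n} f s with f zero in eq
... | suc m = zero , subst (1 ≤_) (sym eq) (s≤s z≤n)
... | zero with sum-positive (f ∘ suc) s
...   | i , p = suc i , p

sum-↑ : ∀ m n (f : Fin (m + n) → ℕ) → sum f ≡ sum (f ∘ (_↑ˡ n)) + sum (f ∘ (m ↑ʳ_))
sum-↑ zero    n f = refl
sum-↑ (suc m) n f = trans (cong (f zero +_) (sum-↑ m n (f ∘ suc))) (sym (+-assoc (f zero) _ _))

ι : Bool → ℕ
ι true  = 1
ι false = 0

ι-mono : ∀ {a b} → (a ≡ true → b ≡ true) → ι a ≤ ι b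
ι-mono {false} _ = z≤n
ι-mono {true}  h rewrite h refl = ≤-refl

ι-∧ : ∀ a b → ι (a ∧ b) ≡ ι a * ι b
ι-∧ true  b = sym (+-identityʳ (ι b))
ι-∧ false b = refl

ι-not : ∀ a → ι a + ι (not a) ≡ 1
ι-not true  = refl
ι-not false = refl

ι-split : ∀ a b → ι b ≡ ι (a ∧ b) + ι (not a ∧ b)
ι-split true  b = sym (+-identityʳ (ι b))
ι-split false b = refl

infix 9 #_
#_ : (Fin n → Bool) → ℕ
# p = sum (ι ∘ p)

#-mono : {p q : Fin n → Bool} → (∀ i → p i ≡ true → q i ≡ true) → # p ≤ # q
#-mono h = sum-mono (λ i → ι-mono (h i))

#-cong : {p q : Fin n → Bool} → (∀ i → p i ≡ q i) → # p ≡ # q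
#-cong h = sum-cong-≗ (cong ι ∘ h)

#-not : (p : Fin n → Bool) → # p + # (not ∘ p) ≡ n
#-not {n = n} p = begin
  # p + # (not ∘ p)                     ≡⟨ ∑-distrib-+ (ι ∘ p) (ι ∘ not ∘ p) ⟨
  sum (λ i → ι (p i) + ι (not (p i)))   ≡⟨ sum-cong-≗ (ι-not ∘ p) ⟩
  sum {n} (λ _ → 1)                     ≡⟨ sum-const n 1 ⟩
  n * 1                                 ≡⟨ *-identityʳ n ⟩
  n                                     ∎
  where open ≡-Reasoning

#-positive : (p : Fin n → Bool) → 1 ≤ # p → ∃ λ i → p i ≡ true
#-positive p s with sum-positive (ι ∘ p) s
... | i , q with p i in eq
...   | true  = i , eq
#-positive p s | i , () | false

∣tabulate∣ : (p : Fin n → Bool) → ∣ tabulate p ∣ ≡ # p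
∣tabulate∣ {n = zero} p = refl
∣tabulate∣ {n = suc n} p with p zero
... | true  = cong suc (∣tabulate∣ (p ∘ suc))
... | false = ∣tabulate∣ (p ∘ suc)

∣lookup∣ : (X : Subset n) → ∣ X ∣ ≡ # (lookup X)
∣lookup∣ X = trans (cong ∣_∣ (sym (tabulate∘lookup X))) (∣tabulate∣ (lookup X))

⟦_⟧ : Fin n → Fin n → Bool
⟦ u ⟧ v = does (u ≟ v)

⟦⟧-refl : (u : Fin n) → ⟦ u ⟧ u ≡ true
⟦⟧-refl u = dec-true (u ≟ u) refl

⟦⟧-≢ : {u v : Fin n} → u ≢ v → ⟦ u ⟧ v ≡ false
⟦⟧-≢ {u = u} {v} = dec-false (u ≟ v)

⟦⟧⇒≡ : {u v : Fin n} → ⟦ u ⟧ v ≡ true → u ≡ v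
⟦⟧⇒≡ {u = u} {v} e with u ≟ v
... | yes p = p

sum-⟦⟧ : (u : Fin n) (f : Fin n → ℕ) → sum (λ v → ι (⟦ u ⟧ v) * f v) ≡ f u
sum-⟦⟧ {n = suc n} zero f = begin
  f zero + 0 + sum {n} (λ _ → 0)  ≡⟨ cong₂ _+_ (+-identityʳ (f zero)) (sum-replicate-zero n) ⟩
  f zero + 0                      ≡⟨ +-identityʳ (f zero) ⟩
  f zero                          ∎
  where open ≡-Reasoning
sum-⟦⟧ {n = suc n} (suc u) f = sum-⟦⟧ u (f ∘ suc)

#⟦⟧ : (u : Fin n) → # ⟦ u ⟧ ≡ 1
#⟦⟧ u = trans (sum-cong-≗ (λ v → sym (*-identityʳ (ι (⟦ u ⟧ v))))) (sum-⟦⟧ u (λ _ → 1))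

-- An equation of indicators says at once that `p` and `q` are disjoint and that `r` is their union,
-- and it can be multiplied by any weight before summing.
_≐_⊎_ : (r p q : Fin n → Bool) → Set
r ≐ p ⊎ q = ∀ i → ι (r i) ≡ ι (p i) + ι (q i)

#-⊎ : (r p q : Fin n → Bool) → r ≐ p ⊎ q → # r ≡ # p + # q
#-⊎ r p q h = trans (sum-cong-≗ h) (∑-distrib-+ (ι ∘ p) (ι ∘ q))

infixl 6 _∪_
_∪_ : (p q : Fin n → Bool) → Fin n → Bool
(p ∪ q) i = p i ∨ q i

∪-disjoint : (p q : Fin n → Bool) → (∀ i → p i ≡ true → q i ≡ false) → (p ∪ q) ≐ p ⊎ q
∪-disjoint p q h i with p i | h i
... | true  | f rewrite f refl = refl
... | false | _ = refl

∪-⟦⟧ : (p : Fin n → Bool) {v : Fin n} → p v ≡ false → (p ∪ ⟦ v ⟧) ≐ p ⊎ ⟦ v ⟧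
∪-⟦⟧ p {v} e = ∪-disjoint p ⟦ v ⟧ λ i pi → ⟦⟧-≢ {u = v} λ { refl → true≢false pi e }

∪-introˡ : (p q : Fin n → Bool) {i : Fin n} → p i ≡ true → (p ∪ q) i ≡ true
∪-introˡ p q e rewrite e = refl

∪-introʳ : (p q : Fin n → Bool) {i : Fin n} → q i ≡ true → (p ∪ q) i ≡ true
∪-introʳ p q {i} e with p i
... | true  = refl
... | false = e

∪-elim : (p q : Fin n → Bool) {i : Fin n} → (p ∪ q) i ≡ true → p i ≡ true ⊎ q i ≡ true
∪-elim p q {i} e with p i
... | true  = inj₁ refl
... | false = inj₂ e

pair : Fin n → Fin n → Fin n → Bool
pair u v = ⟦ u ⟧ ∪ ⟦ v ⟧

pair-⊎ : {u v : Fin n} → u ≢ v → pair u v ≐ ⟦ u ⟧ ⊎ ⟦ v ⟧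
pair-⊎ {u = u} u≢v = ∪-⟦⟧ ⟦ u ⟧ (⟦⟧-≢ u≢v)

#pair : {u v : Fin n} → u ≢ v → # (pair u v) ≡ 2
#pair {u = u} {v} u≢v =
  trans (#-⊎ (pair u v) ⟦ u ⟧ ⟦ v ⟧ (pair-⊎ u≢v)) (cong₂ _+_ (#⟦⟧ u) (#⟦⟧ v))

-- Counting edges

nb : Graph n → (Fin n → Bool) → Fin n → ℕ
nb G q u = # (λ v → q v ∧ adj G u v)

-- Counts ordered pairs, so `edges G p p` is twice the number of edges inside `p`, whereas `cut`
-- counts each boundary edge once.
edges : Graph n → (Fin n → Bool) → (Fin n → Bool) → ℕ
edges G p q = sum (λ u → ι (p u) * nb G q u)

cut : Graph n → (Fin n → Bool) → ℕ
cut G p = edges G p (not ∘ p)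

module _ (G : Graph n) where

  Adj-sym : ∀ {u v} → Adj G u v → Adj G v u
  Adj-sym {u} {v} = subst T (adj-sym G u v)

  Adj-≢ : ∀ {u v} → Adj G u v → u ≢ v
  Adj-≢ {u} a refl = subst T (adj-irr G u) a

  degree≡# : ∀ u → degree G u ≡ # (adj G u)
  degree≡# u = ∣tabulate∣ (adj G u)

  nb-⊎ : ∀ r p q → r ≐ p ⊎ q → ∀ u → nb G r u ≡ nb G p u + nb G q u
  nb-⊎ r p q h u = #-⊎ _ _ _ pointwise
    where
    open ≡-Reasoning
    pointwise : ∀ v → ι (r v ∧ adj G u v) ≡ ι (p v ∧ adj G u v) + ι (q v ∧ adj G u v)
    pointwise v = begin
      ι (r v ∧ adj G u v)                          ≡⟨ ι-∧ (r v) _ ⟩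
      ι (r v) * ι (adj G u v)                      ≡⟨ cong (_* ι (adj G u v)) (h v) ⟩
      (ι (p v) + ι (q v)) * ι (adj G u v)          ≡⟨ *-distribʳ-+ (ι (adj G u v)) (ι (p v)) _ ⟩
      ι (p v) * ι (adj G u v) + ι (q v) * ι (adj G u v)
        ≡⟨ cong₂ _+_ (ι-∧ (p v) _) (ι-∧ (q v) _) ⟨
      ι (p v ∧ adj G u v) + ι (q v ∧ adj G u v)    ∎

  nb-not : ∀ q u → nb G q u + nb G (not ∘ q) u ≡ degree G u
  nb-not q u = sym (trans (degree≡# u) (#-⊎ _ _ _ (λ v → ι-split (q v) (adj G u v))))

  nb-⟦⟧ : ∀ v u → nb G ⟦ v ⟧ u ≡ ι (adj G u v)
  nb-⟦⟧ v u = trans (sum-cong-≗ (λ w → ι-∧ (⟦ v ⟧ w) _)) (sum-⟦⟧ v (ι ∘ adj G u))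

  nb≤degree : ∀ q u → nb G q u ≤ degree G u
  nb≤degree q u = ≤-trans (m≤m+n _ _) (≤-reflexive (nb-not q u))

  edges-double : ∀ p q → edges G p q ≡ sum (λ u → sum (λ v → ι (p u ∧ (q v ∧ adj G u v))))
  edges-double p q = sum-cong-≗ pointwise
    where
    pointwise : ∀ u → ι (p u) * nb G q u ≡ # (λ v → p u ∧ (q v ∧ adj G u v))
    pointwise u with p u
    ... | true  = *-identityˡ _
    ... | false = sym (sum-replicate-zero n)

  edges-sym : ∀ p q → edges G p q ≡ edges G q p
  edges-sym p q = begin
    edges G p q                                               ≡⟨ edges-double p q ⟩
    sum (λ u → sum (λ v → ι (p u ∧ (q v ∧ adj G u v))))       ≡⟨ ∑-comm (λ u v → ι (p u ∧ (q v ∧ adj G u v))) ⟩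
    sum (λ v → sum (λ u → ι (p u ∧ (q v ∧ adj G u v))))
      ≡⟨ sum-cong-≗ (λ v → sum-cong-≗ (λ u → cong ι (swap (p u) (q v) (adj-sym G u v)))) ⟩
    sum (λ v → sum (λ u → ι (q v ∧ (p u ∧ adj G v u))))       ≡⟨ edges-double q p ⟨
    edges G q p                                               ∎
    where
    open ≡-Reasoning
    swap : ∀ a b {c d} → c ≡ d → a ∧ (b ∧ c) ≡ b ∧ (a ∧ d)
    swap true  true  refl = refl
    swap true  false refl = refl
    swap false true  refl = refl
    swap false false refl = refl

  edges-⊎ˡ : ∀ r p q s → r ≐ p ⊎ q → edges G r s ≡ edges G p s + edges G q s
  edges-⊎ˡ r p q s h = trans (sum-cong-≗ pointwise) (∑-distrib-+ (λ u → ι (p u) * nb G s u) (λ u → ι (q u) * nb G s u))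
    where
    pointwise : ∀ u → ι (r u) * nb G s u ≡ ι (p u) * nb G s u + ι (q u) * nb G s u
    pointwise u = trans (cong (_* nb G s u) (h u)) (*-distribʳ-+ _ (ι (p u)) _)

  edges-≤ : ∀ p q c → (∀ u → p u ≡ true → nb G q u ≤ c) → edges G p q ≤ # p * c
  edges-≤ p q c h = ≤-trans (sum-mono pointwise) (≤-reflexive (sum-*ʳ (ι ∘ p) c))
    where
    pointwise : ∀ u → ι (p u) * nb G q u ≤ ι (p u) * c
    pointwise u with p u in eq
    ... | true  = *-monoʳ-≤ 1 (h u eq)
    ... | false = z≤n

  edges-⟦⟧ : ∀ u q → edges G ⟦ u ⟧ q ≡ nb G q u
  edges-⟦⟧ u q = sum-⟦⟧ u (nb G q)

  edges-not : ∀ p q → edges G p q + edges G p (not ∘ q) ≡ sum (λ u → ι (p u) * degree G u)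
  edges-not p q = trans (sym (∑-distrib-+ (λ u → ι (p u) * nb G q u) (λ u → ι (p u) * nb G (not ∘ q) u))) (sum-cong-≗ pointwise)
    where
    pointwise : ∀ u → ι (p u) * nb G q u + ι (p u) * nb G (not ∘ q) u ≡ ι (p u) * degree G u
    pointwise u = trans (sym (*-distribˡ-+ (ι (p u)) _ _)) (cong (ι (p u) *_) (nb-not q u))

  edges-pair : ∀ {u v} → u ≢ v → ∀ q → edges G (pair u v) q ≡ nb G q u + nb G q v
  edges-pair {u} {v} u≢v q = trans (edges-⊎ˡ (pair u v) ⟦ u ⟧ ⟦ v ⟧ q (pair-⊎ u≢v)) (cong₂ _+_ (edges-⟦⟧ u q) (edges-⟦⟧ v q))

  nb-pair : ∀ {u v} → u ≢ v → ∀ w → nb G (pair u v) w ≡ ι (adj G w u) + ι (adj G w v)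
  nb-pair {u} {v} u≢v w = trans (nb-⊎ (pair u v) ⟦ u ⟧ ⟦ v ⟧ (pair-⊎ u≢v) w) (cong₂ _+_ (nb-⟦⟧ u w) (nb-⟦⟧ v w))

  cut-⟦⟧ : ∀ u → cut G ⟦ u ⟧ ≡ degree G u
  cut-⟦⟧ u = begin
    cut G ⟦ u ⟧                                ≡⟨ edges-⟦⟧ u _ ⟩
    nb G (not ∘ ⟦ u ⟧) u                       ≡⟨⟩
    0 + nb G (not ∘ ⟦ u ⟧) u
      ≡⟨ cong (_+ nb G (not ∘ ⟦ u ⟧) u) (trans (nb-⟦⟧ u u) (cong ι (adj-irr G u))) ⟨
    nb G ⟦ u ⟧ u + nb G (not ∘ ⟦ u ⟧) u        ≡⟨ nb-not ⟦ u ⟧ u ⟩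
    degree G u                                 ∎
    where open ≡-Reasoning

  -- The degrees of u and v count the edge uv, if present, from both of its ends; the rest leaves
  -- the pair.
  cut-pair : ∀ {u v} → u ≢ v →
             ι (adj G u v) + ι (adj G u v) + cut G (pair u v) ≡ degree G u + degree G v
  cut-pair {u} {v} u≢v = begin
    ι (adj G u v) + ι (adj G u v) + cut G (pair u v)
      ≡⟨ cong (_+ cut G (pair u v)) (cong₂ _+_ u-inside v-inside) ⟨
    nb G (pair u v) u + nb G (pair u v) v + cut G (pair u v)
      ≡⟨ cong (_+ cut G (pair u v)) (edges-pair u≢v (pair u v)) ⟨
    edges G (pair u v) (pair u v) + cut G (pair u v)        ≡⟨ edges-not (pair u v) (pair u v) ⟩
    sum (λ w → ι (pair u v w) * degree G w)
      ≡⟨ sum-cong-≗ (λ w → trans (cong (_* degree G w) (pair-⊎ u≢v w)) (*-distribʳ-+ (degree G w) (ι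
        (⟦ u ⟧ w)) (ι (⟦ v ⟧ w)))) ⟩
    sum (λ w → ι (⟦ u ⟧ w) * degree G w + ι (⟦ v ⟧ w) * degree G w)   ≡⟨ ∑-distrib-+ (λ w → ι (⟦ u ⟧ w) * degree G w) _ ⟩
    sum (λ w → ι (⟦ u ⟧ w) * degree G w) + sum (λ w → ι (⟦ v ⟧ w) * degree G w)
      ≡⟨ cong₂ _+_ (sum-⟦⟧ u (degree G)) (sum-⟦⟧ v (degree G)) ⟩
    degree G u + degree G v                                 ∎
    where
    open ≡-Reasoning
    u-inside : nb G (pair u v) u ≡ ι (adj G u v)
    u-inside = trans (nb-pair u≢v u) (cong (_+ ι (adj G u v)) (cong ι (adj-irr G u)))
    v-inside : nb G (pair u v) v ≡ ι (adj G u v)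
    v-inside = trans (nb-pair u≢v v)
      (trans (cong₂ _+_ (cong ι (adj-sym G v u)) (cong ι (adj-irr G v))) (+-identityʳ _))

  cut-adjacent : ∀ {u v} → Adj G u v → 2 + cut G (pair u v) ≡ degree G u + degree G v
  cut-adjacent {u} {v} a =
    subst (λ b → ι b + ι b + cut G (pair u v) ≡ degree G u + degree G v) (≡true a) (cut-pair (Adj-≢ a))

  cut-nonadjacent : ∀ {u v} → u ≢ v → ¬ Adj G u v → cut G (pair u v) ≡ degree G u + degree G v
  cut-nonadjacent {u} {v} u≢v a =
    subst (λ b → ι b + ι b + cut G (pair u v) ≡ degree G u + degree G v) (≡false a) (cut-pair u≢v)

  cut-cong : ∀ {p q} → (∀ v → p v ≡ q v) → cut G p ≡ cut G q
  cut-cong h = sum-cong-≗ λ u → cong₂ _*_ (cong ι (h u)) (#-cong λ v → cong (λ b → not b ∧ adj G u v) (h v))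

  cut-not : ∀ p → cut G (not ∘ p) ≡ cut G p
  cut-not p = trans (sum-cong-≗ λ u → cong (ι (not (p u)) *_)
                      (#-cong λ v → cong (_∧ adj G u v) (not-involutive (p v))))
                    (edges-sym (not ∘ p) p)

  regular-edges : ∀ {k} → Regular k G → ∀ p → edges G p p + cut G p ≡ # p * k
  regular-edges {k} reg p = begin
    edges G p p + cut G p                ≡⟨ edges-not p p ⟩
    sum (λ u → ι (p u) * degree G u)     ≡⟨ sum-cong-≗ (λ u → cong (ι (p u) *_) (reg u)) ⟩
    sum (λ u → ι (p u) * k)              ≡⟨ sum-*ʳ (ι ∘ p) k ⟩
    # p * k                              ∎
    where open ≡-Reasoning

-- An equation instead of a set difference allows `H` to be `G` itself when `F` is empty, so that
-- super-λ′ of `G` is an instance of the persistence argument.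
_≅_⊎ᴱ_ : (G H F : Graph n) → Set
G ≅ H ⊎ᴱ F = ∀ u v → ι (adj G u v) ≡ ι (adj H u v) + ι (adj F u v)

∖-decomposes : (G F : Graph n) → F ⊆ᴱ G → G ≅ (G ∖ F) ⊎ᴱ F
∖-decomposes G F F⊆G u v with adj F u v | adj G u v | F⊆G u v
... | false | false | _ = refl
... | false | true  | _ = refl
... | true  | true  | _ = refl
... | true  | false | h = contradiction _ h

module _ (G H F : Graph n) (dec : G ≅ H ⊎ᴱ F) where

  nb-decompose : ∀ q u → nb G q u ≡ nb H q u + nb F q u
  nb-decompose q u = #-⊎ _ _ _ pointwise
    where
    pointwise : ∀ v → ι (q v ∧ adj G u v) ≡ ι (q v ∧ adj H u v) + ι (q v ∧ adj F u v)
    pointwise v with q v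
    ... | true  = dec u v
    ... | false = refl

  cut-decompose : ∀ p → cut G p ≡ cut H p + cut F p
  cut-decompose p = trans
    (sum-cong-≗ λ u → trans (cong (ι (p u) *_) (nb-decompose (not ∘ p) u))
                            (*-distribˡ-+ (ι (p u)) (nb H (not ∘ p) u) (nb F (not ∘ p) u)))
    (∑-distrib-+ (λ u → ι (p u) * nb H (not ∘ p) u) (λ u → ι (p u) * nb F (not ∘ p) u))

  degree-decompose : ∀ u → degree G u ≡ degree H u + degree F u
  degree-decompose u =
    trans (sym (cut-⟦⟧ G u)) (trans (cut-decompose ⟦ u ⟧) (cong₂ _+_ (cut-⟦⟧ H u) (cut-⟦⟧ F u)))

  Adjˡ : ∀ {u v} → Adj H u v → Adj G u v
  Adjˡ {u} {v} a with adj G u v | adj H u v | dec u v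
  ... | true  | _    | _ = _
  ... | false | true | ()

  Adjʳ : ∀ {u v} → Adj F u v → Adj G u v
  Adjʳ {u} {v} a with adj G u v | adj H u v | adj F u v | dec u v
  ... | true  | _     | _    | _ = _
  ... | false | true  | true | ()
  ... | false | false | true | ()

-- Mantel's bound

argmax : (p : Fin n → Bool) (f : Fin n → ℕ) → (∃ λ v → p v ≡ true) →
         ∃ λ u → p u ≡ true × (∀ w → p w ≡ true → f w ≤ f u)
argmax {n = suc n} p f (v , pv) with any? {P = λ i → p (suc i) ≡ true} (λ i → p (suc i) ≟ᵇ true)
... | no none = zero , pzero v pv , only
  where
  pzero : ∀ v → p v ≡ true → p zero ≡ true
  pzero zero    e = e
  pzero (suc i) e = contradiction (i , e) none
  only : ∀ w → p w ≡ true → f w ≤ f zero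
  only zero    _ = ≤-refl
  only (suc i) e = contradiction (i , e) none
... | yes some with argmax (p ∘ suc) (f ∘ suc) some | p zero in p0 | f zero ≤? f (suc (proj₁ (argmax (p ∘ suc) (f ∘ suc) some)))
...   | i , pi , max | false | _ = suc i , pi , λ { zero e → contradiction p0 (true≢false e) ; (suc w) e → max w e }
...   | i , pi , max | true | yes le = suc i , pi , λ { zero _ → le ; (suc w) e → max w e }
...   | i , pi , max | true | no gt = zero , p0 ,
        λ { zero _ → ≤-refl ; (suc w) e → ≤-trans (max w e) (<⇒≤ (≰⇒> gt)) }

-- The two sides differ by the square of x - y; ordering x and y makes z that difference.
4xy≤[x+y]² : ∀ x y → 4 * (x * y) ≤ (x + y) * (x + y)
4xy≤[x+y]² x y with ≤-total x y
... | inj₁ x≤y with m≤n⇒∃[o]m+o≡n x≤y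
...   | z , refl = ≤-trans (m≤m+n _ (z * z)) (≤-reflexive (lemma x z))
  where
  lemma : ∀ x z → 4 * (x * (x + z)) + z * z ≡ (x + (x + z)) * (x + (x + z))
  lemma = solve-∀
4xy≤[x+y]² x y | inj₂ y≤x with m≤n⇒∃[o]m+o≡n y≤x
...   | z , refl = ≤-trans (m≤m+n _ (z * z)) (≤-reflexive (lemma y z))
  where
  lemma : ∀ y z → 4 * ((y + z) * y) + z * z ≡ (y + z + y) * (y + z + y)
  lemma = solve-∀

-- A vertex u of maximum degree Δ inside p has an independent neighbourhood N, so
-- every edge inside p meets p \ N and there are at most Δ (#p − Δ) of them.
mantel : ∀ {k} (G : Graph n) → Regular k G → TriangleFree G → ∀ p →
         2 * (# p * k) ≤ 2 * cut G p + # p * # p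
mantel {k = k} G reg tf p with any? {P = λ i → p i ≡ true} (λ i → p i ≟ᵇ true)
... | no none = subst (λ m → 2 * (m * k) ≤ 2 * cut G p + m * m) (sym empty) z≤n
  where
  empty : # p ≡ 0
  empty with # p in eq
  ... | zero  = refl
  ... | suc m = contradiction (#-positive p (subst (1 ≤_) (sym eq) (s≤s z≤n))) none
... | yes some with argmax p (nb G p) some
...   | u , pu , max = begin
  2 * (# p * k)                             ≡⟨ cong (2 *_) (regular-edges G reg p) ⟨
  2 * (edges G p p + cut G p)               ≤⟨ *-monoʳ-≤ 2 (+-monoˡ-≤ (cut G p) inner) ⟩
  2 * (2 * (# N * # Q) + cut G p)           ≡⟨ lemma (# N * # Q) (cut G p) ⟩
  2 * cut G p + 4 * (# N * # Q)             ≤⟨ +-monoʳ-≤ (2 * cut G p) (4xy≤[x+y]² (# N) (# Q)) ⟩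
  2 * cut G p + (# N + # Q) * (# N + # Q)   ≡⟨ cong (λ m → 2 * cut G p + m * m) (#-⊎ p N Q split) ⟨
  2 * cut G p + # p * # p                   ∎
  where
  open ≤-Reasoning
  N Q : Fin _ → Bool
  N w = p w ∧ adj G u w
  Q w = p w ∧ not (adj G u w)
  split : p ≐ N ⊎ Q
  split w with p w | adj G u w
  ... | false | _     = refl
  ... | true  | true  = refl
  ... | true  | false = refl
  N-degree : ∀ w → N w ≡ true → nb G p w ≤ # Q
  N-degree w Nw = #-mono λ x e →
    cong₂ _∧_ (proj₁ (∧-true e))
      (not-false (≡false λ ux → tf u w x (fromTrue (proj₂ (∧-true {p w} Nw)))
        (fromTrue (proj₂ (∧-true {p x} e))) (Adj-sym G ux)))
  Q-degree : ∀ w → Q w ≡ true → nb G p w ≤ # N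
  Q-degree w Qw = max w (proj₁ (∧-true Qw))
  lemma : ∀ x c → 2 * (2 * x + c) ≡ 2 * c + 4 * x
  lemma = solve-∀
  inner : edges G p p ≤ 2 * (# N * # Q)
  inner = begin
    edges G p p                 ≡⟨ edges-⊎ˡ G p N Q p split ⟩
    edges G N p + edges G Q p   ≤⟨ +-mono-≤ (edges-≤ G N p (# Q) N-degree) (edges-≤ G Q p (# N) Q-degree) ⟩
    # N * # Q + # Q * # N       ≡⟨ twice (# N) (# Q) ⟩
    2 * (# N * # Q)             ∎
    where
    twice : ∀ x y → x * y + y * x ≡ 2 * (x * y)
    twice = solve-∀

-- Edge sets

size≡sum : (F : Graph n) → size F ≡ sum (λ u → # (λ v → does (u <? v) ∧ adj F u v))
size≡sum F = sum-cong-≗ λ u → ∣tabulate∣ (λ v → does (u <? v) ∧ adj F u v)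

size-mono : (F F′ : Graph n) → F ⊆ᴱ F′ → size F ≤ size F′
size-mono F F′ h = subst₂ _≤_ (sym (size≡sum F)) (sym (size≡sum F′))
  (sum-mono λ u → #-mono λ v e →
    cong₂ _∧_ (proj₁ (∧-true {does (u <? v)} e)) (≡true (h u v (fromTrue (proj₂ (∧-true {does (u <? v)} e))))))

-- `size` counts an edge at its smaller end, `cut` at its end in X. Splitting the first count by the
-- end that lies in X and interchanging the summations in one half gives the second.
size-boundary : (G : Graph n) (X : Subset n) → size (boundary G X) ≡ cut G (lookup X)
size-boundary {n = n} G X = begin
  size (boundary G X)
    ≡⟨ size≡sum (boundary G X) ⟩
  sum (λ u → sum (λ v → ι (does (u <? v) ∧ (adj G u v ∧ (X′ u xor X′ v)))))
    ≡⟨ sum-cong-≗ (λ u → trans (sum-cong-≗ (λ v → orient (does (u <? v)) (X′ u) (X′ v) (adj G u v)))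
                               (∑-distrib-+ (λ v → ι (does (u <? v) ∧ t u v)) (λ v → ι (does (u <? v) ∧ t′ u v)))) ⟩
  sum (λ u → sum (λ v → ι (does (u <? v) ∧ t u v)) + sum (λ v → ι (does (u <? v) ∧ t′ u v)))
    ≡⟨ ∑-distrib-+ (λ u → sum (λ v → ι (does (u <? v) ∧ t u v))) (λ u → sum (λ v → ι (does (u <? v) ∧ t′ u v))) ⟩
  sum (λ u → sum (λ v → ι (does (u <? v) ∧ t u v))) + sum (λ u → sum (λ v → ι (does (u <? v) ∧ t′ u v)))
    ≡⟨ cong (sum (λ u → sum (λ v → ι (does (u <? v) ∧ t u v))) +_) flipped ⟩
  sum (λ u → sum (λ v → ι (does (u <? v) ∧ t u v))) + sum (λ u → sum (λ v → ι (does (v <? u) ∧ t u v)))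
    ≡⟨ ∑-distrib-+ (λ u → sum (λ v → ι (does (u <? v) ∧ t u v))) (λ u → sum (λ v → ι (does (v <? u) ∧ t u v))) ⟨
  sum (λ u → sum (λ v → ι (does (u <? v) ∧ t u v)) + sum (λ v → ι (does (v <? u) ∧ t u v)))
    ≡⟨ sum-cong-≗ (λ u → trans (sym (∑-distrib-+ (λ v → ι (does (u <? v) ∧ t u v)) (λ v → ι (does (v <? u) ∧ t u v))))
                               (sum-cong-≗ (both u))) ⟩
  sum (λ u → sum (λ v → ι (t u v)))
    ≡⟨ edges-double G X′ (not ∘ X′) ⟨
  cut G X′ ∎
  where
  open ≡-Reasoning
  X′ : Fin n → Bool
  X′ = lookup X
  t t′ : Fin n → Fin n → Bool
  t u v  = X′ u ∧ (not (X′ v) ∧ adj G u v)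
  t′ u v = X′ v ∧ (not (X′ u) ∧ adj G u v)
  orient : ∀ l x y a → ι (l ∧ (a ∧ (x xor y))) ≡ ι (l ∧ (x ∧ (not y ∧ a))) + ι (l ∧ (y ∧ (not x ∧ a)))
  orient false _     _     _     = refl
  orient true  true  true  true  = refl
  orient true  true  true  false = refl
  orient true  true  false true  = refl
  orient true  true  false false = refl
  orient true  false true  true  = refl
  orient true  false true  false = refl
  orient true  false false true  = refl
  orient true  false false false = refl
  flipped : sum (λ u → sum (λ v → ι (does (u <? v) ∧ t′ u v))) ≡ sum (λ u → sum (λ v → ι (does (v <? u) ∧ t u v)))
  flipped = trans (∑-comm (λ u v → ι (does (u <? v) ∧ t′ u v)))
    (sum-cong-≗ λ v → sum-cong-≗ λ u →
      cong (λ a → ι (does (u <? v) ∧ (X′ v ∧ (not (X′ u) ∧ a)))) (adj-sym G u v))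
  both : ∀ u v → ι (does (u <? v) ∧ t u v) + ι (does (v <? u) ∧ t u v) ≡ ι (t u v)
  both u v with <-cmp u v
  ... | tri< l _ g rewrite dec-true (u <? v) l | dec-false (v <? u) g = +-identityʳ _
  ... | tri> l _ g rewrite dec-false (u <? v) l | dec-true (v <? u) g = refl
  ... | tri≈ l refl g rewrite dec-false (u <? u) l with X′ u
  ...   | true  = refl
  ...   | false = refl

size-boundary-tabulate : (G : Graph n) (p : Fin n → Bool) → size (boundary G (tabulate p)) ≡ cut G p
size-boundary-tabulate G p = trans (size-boundary G (tabulate p)) (cut-cong G (lookup∘tabulate p))

Closed : Graph n → (Fin n → Bool) → Set
Closed G p = ∀ {u v} → Adj G u v → p u ≡ true → p v ≡ true

-- An edge of `G` that leaves a set closed after the removal of `F` must belong to `F`. Lower bounds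
-- on extra edge-cuts pass through this.
cut≤size : (G F : Graph n) (p : Fin n → Bool) → Closed (G ∖ F) p → cut G p ≤ size F
cut≤size G F p closed = subst (_≤ size F) (size-boundary-tabulate G p) (size-mono (boundary G (tabulate p)) F inside)
  where
  inside : boundary G (tabulate p) ⊆ᴱ F
  inside u v e rewrite lookup∘tabulate p u | lookup∘tabulate p v
    with adj G u v in Guv | adj F u v in Fuv | p u in pu | p v in pv
  ... | true | true  | _     | _     = _
  ... | true | false | true  | false =
    contradiction pv (true≢false (closed {u} {v} (fromTrue (cong₂ _∧_ Guv (not-false Fuv))) pu))
  ... | true | false | false | true  =
    contradiction pu (true≢false (closed {v} {u}
      (Adj-sym (G ∖ F) {u} (fromTrue (cong₂ _∧_ Guv (not-false Fuv)))) pv))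

cut-self≤size : (F : Graph n) (p : Fin n → Bool) → cut F p ≤ size F
cut-self≤size F p = cut≤size F F p λ {u} {v} e → contradiction e (none u v)
  where
  none : ∀ u v → ¬ Adj (F ∖ F) u v
  none u v with adj F u v
  ... | true  = λ ()
  ... | false = λ ()

-- Reachability

#-member : (p : Fin n → Bool) {v : Fin n} → p v ≡ true → 1 ≤ # p
#-member p {v} pv = subst (_≤ # p) (#⟦⟧ v) (#-mono λ w e → subst (λ x → p x ≡ true) (⟦⟧⇒≡ {v = w} e) pv)

closed-star : (G : Graph n) (p : Fin n → Bool) → Closed G p →
              ∀ {u v} → Reachable G u v → p u ≡ true → p v ≡ true
closed-star G p closed ε        pu = pu
closed-star G p closed (a ◅ as) pu = closed-star G p closed as (closed a pu)

-- The relation is arbitrary so that this serves paths in a graph and paths inside an induced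
-- subgraph alike.
exit : {R : Fin n → Fin n → Set} (p : Fin n → Bool) → ∀ {u w} → Star R u w → p u ≡ true → p w ≡ false →
       ∃₂ λ x y → p x ≡ true × p y ≡ false × R x y
exit p ε pu pw = contradiction pw (true≢false pu)
exit p {u} (_◅_ {j = v} r rs) pu pw with p v in pv
... | true  = exit p rs pv pw
... | false = u , v , pu , pv , r

Reachable-sym : (G : Graph n) → ∀ {u v} → Reachable G u v → Reachable G v u
Reachable-sym G = reverse (Adj-sym G)

-- A Boolean form of reachability, which makes the vertices of a component countable.
record Component (G : Graph n) (u : Fin n) : Set where
  field
    member    : Fin n → Bool
    sound     : ∀ v → member v ≡ true → Reachable G u v
    complete  : ∀ v → Reachable G u v → member v ≡ true

module _ (G : Graph n) (u : Fin n) where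

  explore : ∀ fuel (p : Fin n → Bool) → n ≤ fuel + # p → p u ≡ true →
            (∀ v → p v ≡ true → Reachable G u v) → Component G u
  explore fuel p enough pu reach
    with any? (λ x → any? (λ y → (p x ≟ᵇ true) ×-dec (p y ≟ᵇ false) ×-dec T? (adj G x y)))
  ... | no none = record { member = p ; sound = reach ; complete = λ v r → closed-star G p closed r pu }
    where
    closed : Closed G p
    closed {x} {y} a px = ≢false λ py → none (x , y , px , py , a)
  -- Without fuel `p` already contains all n vertices, yet y lies outside it.
  explore zero p enough pu reach | yes (x , y , px , py , a) =
    contradiction (≤-trans (≤-reflexive (#-not p)) enough)
      (<⇒≱ (m<m+n (# p) (#-member (not ∘ p) (not-false py))))
  explore (suc fuel) p enough pu reach | yes (x , y , px , py , a) =
    explore fuel (p ∪ ⟦ y ⟧)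
      (≤-trans enough (≤-reflexive (trans (sym (+-suc fuel (# p))) (cong (fuel +_) (sym grown)))))
      (∪-introˡ p ⟦ y ⟧ pu) reach′
    where
    grown : # (p ∪ ⟦ y ⟧) ≡ suc (# p)
    grown = trans (#-⊎ (p ∪ ⟦ y ⟧) p ⟦ y ⟧ (∪-⟦⟧ p py)) (trans (cong (# p +_) (#⟦⟧ y)) (+-comm (# p) 1))
    reach′ : ∀ v → (p ∪ ⟦ y ⟧) v ≡ true → Reachable G u v
    reach′ v e with ∪-elim p ⟦ y ⟧ e
    ... | inj₁ pv = reach v pv
    ... | inj₂ yv = subst (Reachable G u) (⟦⟧⇒≡ yv) (reach x px ◅◅ (a ◅ ε))

  abstract
    component : Component G u
    component = explore n ⟦ u ⟧ (m≤m+n n _) (⟦⟧-refl u) (λ v e → subst (Reachable G u) (⟦⟧⇒≡ e) ε)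

  open Component component public renaming (member to comp; sound to comp-sound; complete to comp-complete)

  comp-refl : comp u ≡ true
  comp-refl = comp-complete u ε

  comp-closed : Closed G comp
  comp-closed {v} {w} a e = comp-complete w (comp-sound v e ◅◅ (a ◅ ε))

∈-tabulate : (p : Fin n → Bool) (v : Fin n) → v ∈ tabulate p ⇔ p v ≡ true
∈-tabulate p v = mk⇔ (λ m → trans (sym (lookup∘tabulate p v)) ([]=⇒lookup m))
                     (λ e → lookup⇒[]= v (tabulate p) (trans (lookup∘tabulate p v) e))

∈-lookup : {X : Subset n} {v : Fin n} → v ∈ X → lookup X v ≡ true
∈-lookup = []=⇒lookup

comp-isComponent : (G : Graph n) (u : Fin n) → IsComponent G (tabulate (comp G u))
comp-isComponent G u = u , λ v →
  mk⇔ (comp-sound G u v ∘ Equivalence.to (∈-tabulate (comp G u) v))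
      (Equivalence.from (∈-tabulate (comp G u) v) ∘ comp-complete G u v)

record Separates (h : ℕ) (G F : Graph n) (u : Fin n) : Set where
  field
    inner : h < # (comp (G ∖ F) u)
    outer : h < # (not ∘ comp (G ∖ F) u)

inhabited : {G : Graph n} → ¬ Connected G → Fin n
inhabited {n = zero}  disc = contradiction (λ ()) disc
inhabited {n = suc n} _    = zero

separates : ∀ {h} {G F : Graph n} → IsExtraEdgeCut h G F → ∀ u → Separates h G F u
separates {n = n} {h} {G} {F} (_ , disc , large) u = record
  { inner = large′ u
  -- The component of a missed vertex w lies in the complement and is large as well.
  ; outer = ≤-trans (large′ w) (#-mono disjoint) }
  where
  H : Graph n
  H = G ∖ F
  large′ : ∀ u → h < # (comp H u)
  large′ u = subst (h <_) (∣tabulate∣ (comp H u)) (large _ (comp-isComponent H u))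
  missed : ∃ λ w → ¬ comp H u w ≡ true
  missed = ¬∀⟶∃¬ n (λ w → comp H u w ≡ true) (λ w → comp H u w ≟ᵇ true)
    λ all → disc λ x y → Reachable-sym H (comp-sound H u x (all x)) ◅◅ comp-sound H u y (all y)
  w : Fin n
  w = proj₁ missed
  disjoint : ∀ x → comp H w x ≡ true → not (comp H u x) ≡ true
  disjoint x e with comp H u x in ux
  ... | false = refl
  ... | true  = contradiction
    (comp-complete H u w (comp-sound H u x ux ◅◅ Reachable-sym H (comp-sound H w x e))) (proj₂ missed)

comp-cut≤size : (G F : Graph n) (u : Fin n) → cut G (comp (G ∖ F) u) ≤ size F
comp-cut≤size G F u = cut≤size G F _ λ {v} {w} → comp-closed (G ∖ F) u {v} {w}

-- Extra edge-cuts arising as boundaries of vertex sets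

module _ (G : Graph n) (p : Fin n → Bool) where

  cutOff : Graph n
  cutOff = boundary G (tabulate p)

  cutOff-keeps : ∀ {u v} → Adj G u v → p u ≡ p v → Adj (G ∖ cutOff) u v
  cutOff-keeps {u} {v} a e rewrite lookup∘tabulate p u | lookup∘tabulate p v | e | ≡true a with p v
  ... | true  = _
  ... | false = _

  cutOff-closed : Closed (G ∖ cutOff) p
  cutOff-closed {u} {v} a pu rewrite lookup∘tabulate p u | lookup∘tabulate p v | pu
    with adj G u v | p v
  ... | true | true = refl

  -- It is enough that every vertex still reaches more than h vertices; the components need not be
  -- known.
  cutOff-extra : ∀ {h} → (∃ λ u → p u ≡ true) → (∃ λ v → p v ≡ false) →
                 (∀ u → ∃ λ q → h < # q × (∀ v → q v ≡ true → Reachable (G ∖ cutOff) u v)) →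
                 IsExtraEdgeCut h G cutOff
  cutOff-extra {h} (u , pu) (v , pv) large =
      (λ x y e → fromTrue (proj₁ (∧-true (≡true e))))
    , (λ conn → true≢false (closed-star (G ∖ cutOff) p (λ {x} {y} → cutOff-closed {x} {y}) (conn u v) pu) pv)
    , λ { C (w , isC) → let q , h<q , r = large w in
          ≤-trans h<q (≤-trans (#-mono λ x qx → ∈-lookup (Equivalence.from (isC x) (r x qx)))
                               (≤-reflexive (sym (∣lookup∣ C)))) }

  cutOff-extra₀ : (∃ λ u → p u ≡ true) → (∃ λ v → p v ≡ false) → IsExtraEdgeCut 0 G cutOff
  cutOff-extra₀ in′ out′ = cutOff-extra in′ out′ λ u →
    ⟦ u ⟧ , ≤-reflexive (sym (#⟦⟧ u)) , λ v e → subst (Reachable (G ∖ cutOff) u) (⟦⟧⇒≡ e) ε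

  cutOff-extra₁ : (∃ λ u → p u ≡ true) → (∃ λ v → p v ≡ false) →
                  (∀ u → ∃ λ v → p u ≡ p v × Adj G u v) → IsExtraEdgeCut 1 G cutOff
  cutOff-extra₁ in′ out′ nbr = cutOff-extra in′ out′ λ u → let v , e , a = nbr u in
    pair u v , ≤-reflexive (sym (#pair (Adj-≢ G a))) , λ w m →
      [ (λ uw → subst (Reachable (G ∖ cutOff) u) (⟦⟧⇒≡ uw) ε)
      , (λ vw → subst (Reachable (G ∖ cutOff) u) (⟦⟧⇒≡ vw) (cutOff-keeps a e ◅ ε)) ]′ (∪-elim ⟦ u ⟧ ⟦ v ⟧ m)

least : {A : Set} {P : A → Set} (f : A → ℕ) →
        (∀ a → (∃ λ b → P b × f b < f a) ⊎ (∀ b → P b → f a ≤ f b)) →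
        ∃ P → ∃ λ a → P a × (∀ b → P b → f a ≤ f b)
least {A} {P} f step (a , pa) = descend (f a) a pa ≤-refl
  where
  descend : ∀ m a → P a → f a ≤ m → ∃ λ a → P a × (∀ b → P b → f a ≤ f b)
  descend m a pa le with step a
  ... | inj₂ min = a , pa , min
  descend zero    a pa le | inj₁ (b , pb , lt) = contradiction (≤-trans lt le) λ ()
  descend (suc m) a pa le | inj₁ (b , pb , lt) = descend m b pb (≤-pred (≤-trans lt le))

-- The numerical core

-- a vertices of a graph of order n, the α other ones, and d edges between them.
record Side (k n l a α d : ℕ) : Set where
  field
    total : a + α ≡ n
    low   : 1 ≤ a → 1 ≤ α → k ≤ d
    high  : 2 ≤ a → 2 ≤ α → l ≤ d
    inner : 2 * (a * k) ≤ 2 * d + a * a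
    outer : 2 * (α * k) ≤ 2 * d + α * α

flip : ∀ {k n l a α d} → Side k n l a α d → Side k n l α a d
flip {a = a} {α} s = record
  { total = trans (+-comm α a) total ; low = λ p q → low q p ; high = λ p q → high q p
  ; inner = outer ; outer = inner }
  where open Side s

-- With c = 2k - b Mantel's bound becomes b(2k - b) ≤ 2d; the equation for c avoids subtraction.
mantel-quadratic : ∀ {k b c d} → 2 * k ≡ b + c → 2 * (b * k) ≤ 2 * d + b * b → b * c ≤ 2 * d
mantel-quadratic {k} {b} {c} {d} e h = +-cancelʳ-≤ (b * b) _ _ (begin
  b * c + b * b     ≡⟨ *-distribˡ-+ b c b ⟨
  b * (c + b)       ≡⟨ cong (b *_) (trans (+-comm c b) (sym e)) ⟩
  b * (2 * k)       ≡⟨ lemma b k ⟩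
  2 * (b * k)       ≤⟨ h ⟩
  2 * d + b * b     ∎)
  where
  open ≤-Reasoning
  lemma : ∀ b k → b * (2 * k) ≡ 2 * (b * k)
  lemma = solve-∀

-- The case of a set inside one copy, all of whose b matching edges lie in the boundary. For 4 ≤ b ≤
-- 2k - 2 the sum b(2k - b)/2 + b is concave with value 4k - 4 at both ends, and 4k - 4 ≥ 3k. For
-- larger b the λ′-bound k + 2 is enough, unless the complement has fewer than two vertices, and
-- then b ≥ n - 1.
avoid : ∀ {k n l b β d m} → 4 ≤ k → 3 * k ≤ n → k + 2 ≤ l → Side k n l b β d →
        4 ≤ b → b ≤ m → 3 * k ≤ d + m
avoid {k} {n} {l} {b} {zero} {d} {m} 4≤k 3k≤n k<l s 4≤b b≤m = begin
  3 * k   ≤⟨ 3k≤n ⟩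
  n       ≡⟨ Side.total s ⟨
  b + 0   ≡⟨ +-identityʳ b ⟩
  b       ≤⟨ b≤m ⟩
  m       ≤⟨ m≤n+m m d ⟩
  d + m   ∎
  where open ≤-Reasoning
avoid {k} {n} {l} {b} {1} {d} {m} 4≤k 3k≤n k<l s 4≤b b≤m = begin
  3 * k   ≤⟨ 3k≤n ⟩
  n       ≡⟨ Side.total s ⟨
  b + 1   ≡⟨ +-comm b 1 ⟩
  1 + b   ≤⟨ +-mono-≤ (≤-trans (≤-trans (s≤s z≤n) 4≤k) (Side.low s (≤-trans (s≤s z≤n) 4≤b) ≤-refl)) b≤m ⟩
  d + m   ∎
  where open ≤-Reasoning
avoid {k} {n} {l} {b} {suc (suc β)} {d} {m} 4≤k 3k≤n k<l s 4≤b b≤m with 2 * k ≤? b + 1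
... | yes 2k≤ = begin
  k + 2 * k       ≤⟨ +-monoʳ-≤ k 2k≤ ⟩
  k + (b + 1)     ≤⟨ +-monoʳ-≤ k (+-monoʳ-≤ b (s≤s z≤n)) ⟩
  k + (b + 2)     ≡⟨ lemma k b ⟩
  k + 2 + b       ≤⟨ +-mono-≤ (≤-trans k<l (Side.high s (≤-trans (s≤s (s≤s z≤n)) 4≤b) (s≤s (s≤s z≤n)))) b≤m ⟩
  d + m           ∎
  where
  open ≤-Reasoning
  lemma : ∀ k b → k + (b + 2) ≡ k + 2 + b
  lemma = solve-∀
... | no 2k≰ with m≤n⇒∃[o]m+o≡n 4≤b | m≤n⇒∃[o]m+o≡n (≰⇒> 2k≰)
-- Here x = b - 4 and y = 2k - 2 - b are the distances to the ends of the range, and their product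
-- is twice the surplus over the value there.
...   | x , refl | y , 2k≡ = *-cancelˡ-≤ 2 (+-cancelʳ-≤ 8 _ _ (begin
  2 * (3 * k) + 8                               ≤⟨ +-monoʳ-≤ (2 * (3 * k)) (*-monoʳ-≤ 2 4≤k) ⟩
  2 * (3 * k) + 2 * k                           ≡⟨ lemma₁ k ⟩
  4 * (2 * k)                                   ≡⟨ cong (4 *_) 2k≡ ⟨
  4 * (suc (4 + x + 1) + y)                     ≤⟨ m≤m+n _ (x * y) ⟩
  4 * (suc (4 + x + 1) + y) + x * y             ≡⟨ lemma₂ x y ⟩
  (4 + x) * (2 + y) + 2 * (4 + x) + 8
    ≤⟨ +-monoˡ-≤ 8 (+-mono-≤ (mantel-quadratic {k} {4 + x} {2 + y} {d} (trans (sym 2k≡) (lemma₃ x y))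
      (Side.inner s)) (*-monoʳ-≤ 2 b≤m)) ⟩
  2 * d + 2 * m + 8                             ≡⟨ cong (_+ 8) (*-distribˡ-+ 2 d m) ⟨
  2 * (d + m) + 8                               ∎))
  where
  open ≤-Reasoning
  lemma₁ : ∀ k → 2 * (3 * k) + 2 * k ≡ 4 * (2 * k)
  lemma₁ = solve-∀
  lemma₂ : ∀ x y → 4 * (suc (4 + x + 1) + y) + x * y ≡ (4 + x) * (2 + y) + 2 * (4 + x) + 8
  lemma₂ = solve-∀
  lemma₃ : ∀ x y → suc (4 + x + 1) + y ≡ 4 + x + (2 + y)
  lemma₃ = solve-∀

-- The case of one further vertex in the other copy, with boundary d′ there; it may absorb one
-- matching edge, hence 1 + m. As d′ supplies k, the sum b(2k - b)/2 + b has to reach only 2k + 1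
-- for 3 ≤ b ≤ 2k - 1, and it equals 3k - 3/2 at both ends.
touch : ∀ {k n l b β d d′ m} → 4 ≤ k → 3 * k ≤ n → k + 2 ≤ l → Side k n l b β d →
        3 ≤ b → b ≤ 1 + m → k ≤ d′ → 3 * k ≤ d′ + (d + m)
touch {k} {n} {l} {b} {β} {d} {d′} {m} 4≤k 3k≤n k<l s 3≤b b≤1+m k≤d′ with 2 ≤? β
... | no β≱2 = begin
  3 * k           ≤⟨ 3k≤n ⟩
  n               ≡⟨ Side.total s ⟨
  b + β           ≤⟨ +-mono-≤ b≤1+m (≤-pred (≰⇒> β≱2)) ⟩
  1 + m + 1       ≡⟨ +-comm (1 + m) 1 ⟩
  2 + m           ≤⟨ +-mono-≤ (≤-trans (≤-trans (s≤s (s≤s z≤n)) 4≤k) k≤d′) (m≤n+m m d) ⟩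
  d′ + (d + m)    ∎
  where open ≤-Reasoning
... | yes 2≤β with 2 * k ≤? b
...   | yes 2k≤b = begin
  k + 2 * k       ≤⟨ +-mono-≤ k≤d′ (≤-trans 2k≤b b≤1+m) ⟩
  d′ + (1 + m)
    ≤⟨ +-monoʳ-≤ d′ (+-monoˡ-≤ m (≤-trans (≤-trans (≤-trans (s≤s z≤n) (m≤n+m 2 k)) k<l) (Side.high s (≤-trans
      (s≤s (s≤s z≤n)) 3≤b) 2≤β))) ⟩
  d′ + (d + m)    ∎
  where open ≤-Reasoning
...   | no 2k≰b with m≤n⇒∃[o]m+o≡n 3≤b | m≤n⇒∃[o]m+o≡n (≰⇒> 2k≰b)
...     | x , refl | y , 2k≡ = *-cancelˡ-≤ 2 (+-cancelʳ-≤ 2 _ _ (begin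
  2 * (3 * k) + 2                                  ≡⟨ lemma₁ k ⟩
  2 * k + 2 * (2 * k) + 2                          ≡⟨ cong (λ z → 2 * k + 2 * z + 2) 2k≡ ⟨
  2 * k + 2 * (suc (3 + x) + y) + 2                ≡⟨ lemma₂ (2 * k) x y ⟩
  2 * k + (9 + 2 * (x + y)) + 1                    ≤⟨ +-monoʳ-≤ (2 * k + (9 + 2 * (x + y))) 1≤x+y ⟩
  2 * k + (9 + 2 * (x + y)) + (x + y)              ≤⟨ m≤m+n _ (x * y) ⟩
  2 * k + (9 + 2 * (x + y)) + (x + y) + x * y      ≡⟨ lemma₃ (2 * k) x y ⟩
  2 * k + ((3 + x) * (1 + y) + 2 * (3 + x))
    ≤⟨ +-mono-≤ (*-monoʳ-≤ 2 k≤d′) (+-mono-≤ (mantel-quadratic {k} {3 + x} {1 + y} {d} (trans (sym 2k≡)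
      (lemma₄ x y)) (Side.inner s)) (*-monoʳ-≤ 2 b≤1+m)) ⟩
  2 * d′ + (2 * d + 2 * (1 + m))                   ≡⟨ lemma₅ d′ d m ⟩
  2 * (d′ + (d + m)) + 2                           ∎))
  where
  open ≤-Reasoning
  lemma₁ : ∀ k → 2 * (3 * k) + 2 ≡ 2 * k + 2 * (2 * k) + 2
  lemma₁ = solve-∀
  lemma₂ : ∀ z x y → z + 2 * (suc (3 + x) + y) + 2 ≡ z + (9 + 2 * (x + y)) + 1
  lemma₂ = solve-∀
  lemma₃ : ∀ z x y → z + (9 + 2 * (x + y)) + (x + y) + x * y ≡ z + ((3 + x) * (1 + y) + 2 * (3 + x))
  lemma₃ = solve-∀
  lemma₄ : ∀ x y → suc (3 + x) + y ≡ 3 + x + (1 + y)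
  lemma₄ = solve-∀
  lemma₅ : ∀ a b c → 2 * a + (2 * b + 2 * (1 + c)) ≡ 2 * (a + (b + c)) + 2
  lemma₅ = solve-∀
  1≤x+y : 1 ≤ x + y
  1≤x+y = +-cancelˡ-≤ 4 _ _ (begin
    4 + 1             ≤⟨ m≤m+n 5 3 ⟩
    8                 ≤⟨ *-monoʳ-≤ 2 4≤k ⟩
    2 * k             ≡⟨ 2k≡ ⟨
    4 + (x + y)       ∎)

-- The two inequalities between a, b and m say that a matching pairs the a vertices of one
-- side with the b vertices of the other one up to m unmatched ends.
module _ {k n l l′ : ℕ} (4≤k : 4 ≤ k) (3k≤n : 3 * k ≤ n) (sum≥ : 3 * k ≤ l + l′)
         (k<l : k + 2 ≤ l) (k<l′ : k + 2 ≤ l′) where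

  -- Both copies have n vertices, so the matching estimate for a set is the one for its complement
  -- with the copies exchanged.
  complement-≤ : ∀ {a α b β m} → a + α ≡ n → b + β ≡ n → a ≤ b + m → β ≤ α + m
  complement-≤ {a} {α} {b} {β} {m} e e′ h = +-cancelˡ-≤ b _ _ (begin
    b + β           ≡⟨ trans e′ (sym e) ⟩
    a + α           ≤⟨ +-monoˡ-≤ α h ⟩
    b + m + α       ≡⟨ lemma b m α ⟩
    b + (α + m)     ∎)
    where
    open ≤-Reasoning
    lemma : ∀ b m α → b + m + α ≡ b + (α + m)
    lemma = solve-∀

  private
    few : ∀ {l₀ l₁ a α b β d d′ m} → k + 2 ≤ l₁ → Side k n l₀ a α d → Side k n l₁ b β d′ → b ≤ a + m →
          4 ≤ a + b → a ≤ 1 → 3 * k ≤ d + d′ + m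
    few {d = d} {d′} {m} k<l₁ s s′ le four z≤n =
      ≤-trans (avoid 4≤k 3k≤n k<l₁ s′ four le) (≤-trans (m≤n+m _ d) (≤-reflexive (sym (+-assoc d d′ m))))
    few {α = α} {d = d} {d′} {m} k<l₁ s s′ le four (s≤s z≤n) =
      ≤-trans (touch 4≤k 3k≤n k<l₁ s′ (≤-pred four) le (Side.low s ≤-refl 1≤α)) (≤-reflexive (sym (+-assoc d d′ m)))
      where
      1≤α : 1 ≤ α
      1≤α = +-cancelˡ-≤ 1 _ _ (≤-trans (≤-trans (≤-trans (s≤s (s≤s z≤n)) 4≤k) (m≤n*m k 3))
        (≤-trans 3k≤n (≤-reflexive (sym (Side.total s)))))

  -- If all four parts have two vertices, the λ′-bounds of the copies add up to 3k. Otherwise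
  -- exchanging copies and taking complements moves a part with at most one vertex to the first
  -- place, where `few` chooses between `avoid` and `touch`.
  numeric-core : ∀ {a α b β d d′ m} → Side k n l a α d → Side k n l′ b β d′ →
                 a ≤ b + m → b ≤ a + m → 4 ≤ a + b → 4 ≤ α + β → 3 * k ≤ d + d′ + m
  numeric-core {a} {α} {b} {β} {d} {d′} {m} s s′ h h′ four four′
    with 2 ≤? a | 2 ≤? α | 2 ≤? b | 2 ≤? β
  ... | no a<2 | _ | _ | _ = few k<l′ s s′ h′ four (≤-pred (≰⇒> a<2))
  ... | yes _ | no α<2 | _ | _ =
    few k<l′ (flip s) (flip s′) (complement-≤ (Side.total s) (Side.total s′) h) four′ (≤-pred (≰⇒> α<2))
  ... | yes _ | yes _ | no b<2 | _ =
    subst (λ z → 3 * k ≤ z + m) (+-comm d′ d)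
      (few k<l s′ s h (subst (4 ≤_) (+-comm a b) four) (≤-pred (≰⇒> b<2)))
  ... | yes _ | yes _ | yes _ | no β<2 =
    subst (λ z → 3 * k ≤ z + m) (+-comm d′ d)
      (few k<l (flip s′) (flip s) (complement-≤ (Side.total s′) (Side.total s) h′)
        (subst (4 ≤_) (+-comm α β) four′) (≤-pred (≰⇒> β<2)))
  ... | yes 2≤a | yes 2≤α | yes 2≤b | yes 2≤β =
    ≤-trans sum≥ (≤-trans (+-mono-≤ (Side.high s 2≤a 2≤α) (Side.high s′ 2≤b 2≤β)) (m≤m+n _ m))

  private
    proper₀ : ∀ {l₀ l₁ a α b β d d′ m} → Side k n l₀ a α d → Side k n l₁ b β d′ → b ≤ a + m →
              1 ≤ a + b → a ≤ 0 → k + 1 ≤ d + d′ + m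
    proper₀ {b = b} {zero} {d} {d′} {m} s s′ le one z≤n = begin
      k + 1           ≤⟨ +-monoʳ-≤ k (≤-trans (≤-trans (s≤s z≤n) 4≤k) (m≤m+n k (k + 0))) ⟩
      3 * k           ≤⟨ 3k≤n ⟩
      n               ≡⟨ trans (sym (+-identityʳ b)) (Side.total s′) ⟨
      b               ≤⟨ le ⟩
      m               ≤⟨ m≤n+m m (d + d′) ⟩
      d + d′ + m      ∎
      where open ≤-Reasoning
    proper₀ {β = suc β} {d} {d′} {m} s s′ le one z≤n =
      +-mono-≤ (≤-trans (Side.low s′ one (s≤s z≤n)) (m≤n+m d′ d)) (≤-trans one le)

  -- Cutting both copies properly gives 2k. A set missing one copy has at least one matching edge on
  -- top of k, or n matching edges if it fills the other copy.
  numeric-proper : ∀ {a α b β d d′ m} → Side k n l a α d → Side k n l′ b β d′ →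
                   a ≤ b + m → b ≤ a + m → 1 ≤ a + b → 1 ≤ α + β → k + 1 ≤ d + d′ + m
  numeric-proper {a} {α} {b} {β} {d} {d′} {m} s s′ h h′ one one′
    with 1 ≤? a | 1 ≤? α | 1 ≤? b | 1 ≤? β
  ... | no a<1 | _ | _ | _ = proper₀ s s′ h′ one (≤-pred (≰⇒> a<1))
  ... | yes _ | no α<1 | _ | _ =
    proper₀ (flip s) (flip s′) (complement-≤ (Side.total s) (Side.total s′) h) one′ (≤-pred (≰⇒> α<1))
  ... | yes _ | yes _ | no b<1 | _ =
    subst (λ z → k + 1 ≤ z + m) (+-comm d′ d)
      (proper₀ s′ s h (subst (1 ≤_) (+-comm a b) one) (≤-pred (≰⇒> b<1)))
  ... | yes _ | yes _ | yes _ | no β<1 =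
    subst (λ z → k + 1 ≤ z + m) (+-comm d′ d)
      (proper₀ (flip s′) (flip s) (complement-≤ (Side.total s′) (Side.total s) h′)
        (subst (1 ≤_) (+-comm α β) one′) (≤-pred (≰⇒> β<1)))
  ... | yes 1≤a | yes 1≤α | yes 1≤b | yes 1≤β =
    ≤-trans (+-mono-≤ (Side.low s 1≤a 1≤α) (≤-trans (≤-trans (s≤s z≤n) 4≤k) (Side.low s′ 1≤b 1≤β))) (m≤m+n _ m)

-- Boundaries of one copy

nb-witness : (G : Graph n) (q : Fin n → Bool) (u : Fin n) → 1 ≤ nb G q u → ∃ λ v → q v ≡ true × Adj G u v
nb-witness G q u h with #-positive (λ v → q v ∧ adj G u v) h
... | v , e = v , proj₁ (∧-true e) , fromTrue (proj₂ (∧-true {q v} e))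

Adj⇒1≤degree : (G : Graph n) → ∀ {u v} → Adj G u v → 1 ≤ degree G u
Adj⇒1≤degree G {u} a = subst (1 ≤_) (sym (degree≡# G u)) (#-member (adj G u) (≡true a))

triangle-free-pair : (G : Graph n) → TriangleFree G → ∀ {u v} → Adj G u v → ∀ z → nb G (pair u v) z ≤ 1
triangle-free-pair G tf {u} {v} a z =
  subst (_≤ 1) (sym (nb-pair G (Adj-≢ G a) z)) (bound (tf z u v))
  where
  bound : (Adj G z u → Adj G u v → ¬ Adj G v z) → ι (adj G z u) + ι (adj G z v) ≤ 1
  bound t with adj G z u | adj G z v in zv
  ... | false | false = z≤n
  ... | false | true  = ≤-refl
  ... | true  | false = ≤-refl
  ... | true  | true  = contradiction (Adj-sym G (fromTrue zv)) (t _ a)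

pairˡ : (u v : Fin n) → pair u v u ≡ true
pairˡ u v = ∪-introˡ ⟦ u ⟧ ⟦ v ⟧ (⟦⟧-refl u)

pairʳ : (u v : Fin n) → pair u v v ≡ true
pairʳ u v = ∪-introʳ ⟦ u ⟧ ⟦ v ⟧ (⟦⟧-refl v)

pair-extra : (G : Graph n) → ∀ {u v} → Adj G u v → (∃ λ z → pair u v z ≡ false) →
             (∀ z → pair u v z ≡ false → ∃ λ w → pair u v w ≡ false × Adj G z w) →
             IsExtraEdgeCut 1 G (cutOff G (pair u v))
pair-extra {n = n} G {u} {v} a outside nbr = cutOff-extra₁ G (pair u v) (u , pairˡ u v) outside partner
  where
  partner : ∀ x → ∃ λ y → pair u v x ≡ pair u v y × Adj G x y
  partner x with pair u v x in e
  ... | false = let w , f , b = nbr x e in w , sym f , b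
  ... | true with ∪-elim ⟦ u ⟧ ⟦ v ⟧ {x} e
  ...   | inj₁ ux = v , sym (pairʳ u v) , subst (λ y → Adj G y v) (⟦⟧⇒≡ ux) a
  ...   | inj₂ vx = u , sym (pairˡ u v) , subst (λ y → Adj G y u) (⟦⟧⇒≡ vx) (Adj-sym G a)

-- All k edges at u leave `p`. The set without u has boundary at least k, and none of these edges
-- ends at u, so they leave `p` too.
isolated-cut : ∀ {k} (G : Graph n) → Regular k G →
               (∀ p → 1 ≤ # p → 1 ≤ # (not ∘ p) → k ≤ cut G p) →
               ∀ p u → p u ≡ true → (∀ v → p v ≡ true → ¬ Adj G u v) →
               2 ≤ # p → 1 ≤ # (not ∘ p) → k + k ≤ cut G p
isolated-cut {n = n} {k} G reg proper p u pu iso 2≤p 1≤p̄ = begin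
  k + k                                                ≤⟨ +-monoˡ-≤ k (proper p′ 1≤p′ (≤-trans 1≤p̄ (#-mono bigger))) ⟩
  cut G p′ + k                                         ≤⟨ +-monoˡ-≤ k (sum-mono moved) ⟩
  edges G p′ (not ∘ p) + k                             ≡⟨ cong (edges G p′ (not ∘ p) +_) all-out ⟨
  edges G p′ (not ∘ p) + nb G (not ∘ p) u              ≡⟨ cong (edges G p′ (not ∘ p) +_) (edges-⟦⟧ G u (not ∘ p)) ⟨
  edges G p′ (not ∘ p) + edges G ⟦ u ⟧ (not ∘ p)       ≡⟨ edges-⊎ˡ G p p′ ⟦ u ⟧ (not ∘ p) split ⟨
  cut G p                                              ∎
  where
  open ≤-Reasoning
  p′ : Fin n → Bool
  p′ w = p w ∧ not (⟦ u ⟧ w)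
  split : p ≐ p′ ⊎ ⟦ u ⟧
  split w with u ≟ w
  ... | yes refl rewrite pu = refl
  ... | no _ with p w
  ...   | true  = refl
  ...   | false = refl
  1≤p′ : 1 ≤ # p′
  1≤p′ = +-cancelʳ-≤ 1 _ _ (≤-trans 2≤p
    (≤-reflexive (trans (#-⊎ p p′ ⟦ u ⟧ split) (cong (# p′ +_) (#⟦⟧ u)))))
  bigger : ∀ w → not (p w) ≡ true → not (p′ w) ≡ true
  bigger w e rewrite not-true {p w} e = refl
  all-out : nb G (not ∘ p) u ≡ k
  all-out = trans (sym (cong (_+ nb G (not ∘ p) u) none)) (trans (nb-not G p u) (reg u))
    where
    none : nb G p u ≡ 0
    none with nb G p u in eq
    ... | zero  = refl
    ... | suc _ = let v , pv , a = nb-witness G p u (subst (1 ≤_) (sym eq) (s≤s z≤n)) in contradiction a (iso v pv)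
  moved : ∀ w → ι (p′ w) * nb G (not ∘ p′) w ≤ ι (p′ w) * nb G (not ∘ p) w
  moved w with p w in pw | u ≟ w
  ... | false | _     = z≤n
  ... | true  | yes _ = z≤n
  ... | true  | no _  = *-monoʳ-≤ 1 (#-mono λ v e →
      cong₂ _∧_ (out v (proj₁ (∧-true e)) (proj₂ (∧-true {not (p′ v)} e))) (proj₂ (∧-true {not (p′ v)} e)))
    where
    out : ∀ v → not (p′ v) ≡ true → adj G w v ≡ true → not (p v) ≡ true
    out v e a with p v | u ≟ v
    ... | false | _ = refl
    ... | true  | yes refl = contradiction (Adj-sym G (fromTrue a)) (iso w pw)

module _ {k l : ℕ} (G : Graph n) (tf : TriangleFree G) (reg : Regular k G) (3k≤n : 3 * k ≤ n) where

  superλ-cut : Super 0 G → ∀ p → 1 ≤ # p → 1 ≤ # (not ∘ p) → k ≤ cut G p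
  superλ-cut ((m , (_ , _ , minimal) , ((X , (_ , one , _) , dX) , _)) , _) p in′ out′ = begin
    k                                    ≤⟨ k≤m ⟩
    m                                    ≤⟨ minimal (cutOff G p) (cutOff-extra₀ G p (#-positive p in′) outside) ⟩
    size (boundary G (tabulate p))       ≡⟨ size-boundary-tabulate G p ⟩
    cut G p                              ∎
    where
    open ≤-Reasoning
    outside : ∃ λ v → p v ≡ false
    outside = let v , e = #-positive (not ∘ p) out′ in v , not-true e
    k≤m : k ≤ m
    -- Mantel's bound for the one-vertex set attaining ξ₀ gives 2k ≤ 2m + 1, which rounds to k ≤ m.
    k≤m = ≤-pred (*-cancelˡ-< 2 k (suc m) (begin-strict
      2 * k                                                  ≡⟨ cong (2 *_) (*-identityˡ k) ⟨
      2 * (1 * k)                                            ≡⟨ cong (λ z → 2 * (z * k)) #X ⟨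
      2 * (# (lookup X) * k)                                 ≤⟨ mantel G reg tf (lookup X) ⟩
      2 * cut G (lookup X) + # (lookup X) * # (lookup X)
        ≡⟨ cong₂ (λ a b → 2 * a + b * b) (trans (sym (size-boundary G X)) dX) #X ⟩
      2 * m + 1                                              <⟨ ≤-reflexive (lemma m) ⟩
      2 * suc m                                              ∎))
      where
      #X : # (lookup X) ≡ 1
      #X = trans (sym (∣lookup∣ X)) one
      lemma : ∀ m → suc (2 * m + 1) ≡ 2 * suc m
      lemma = solve-∀

  module _ (super : Super 0 G) (λ′ : IsExtraEdgeConnectivity 1 G l) where

    private
      proper = superλ-cut super

      -- The existence of λ′ excludes k = 0: an extra cut leaves two components, so the connected
      -- graph has two vertices and hence an edge.
      some-edge : ∃₂ λ u v → Adj G u v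
      some-edge = let
          conn , ((F , (extra , _)) , _) = λ′
          u = inhabited {G = G ∖ F} (proj₁ (proj₂ extra))
          w , w∉ = #-positive (not ∘ comp (G ∖ F) u) (≤-trans (s≤s z≤n) (Separates.outer (separates {G = G} {F} extra u)))
          x , y , _ , _ , a = exit ⟦ u ⟧ (conn u w) (⟦⟧-refl u)
            (⟦⟧-≢ λ u≡w → true≢false (comp-refl (G ∖ F) u) (trans (cong (comp (G ∖ F) u) u≡w) (not-true w∉)))
        in x , y , a

    -- The boundary of an edge is a 1-extra cut: without triangles an outside vertex has at most one
    -- neighbour on the edge, and hence another one outside as k ≥ 2.
    λ′-upper : l + 2 ≤ 2 * k
    λ′-upper = begin
      l + 2                       ≤⟨ +-monoˡ-≤ 2 (proj₂ (proj₂ λ′) (cutOff G p) (pair-extra G a outside nbr)) ⟩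
      size (cutOff G p) + 2       ≡⟨ cong (_+ 2) (size-boundary-tabulate G p) ⟩
      cut G p + 2                 ≡⟨ +-comm _ 2 ⟩
      2 + cut G p                 ≡⟨ cut≡ ⟩
      k + k                       ≡⟨ cong (k +_) (+-identityʳ k) ⟨
      2 * k                       ∎
      where
      open ≤-Reasoning
      u v : Fin n
      u = proj₁ some-edge
      v = proj₁ (proj₂ some-edge)
      a : Adj G u v
      a = proj₂ (proj₂ some-edge)
      p : Fin n → Bool
      p = pair u v
      cut≡ : 2 + cut G p ≡ k + k
      cut≡ = trans (cut-adjacent G a) (cong₂ _+_ (reg u) (reg v))
      1≤k : 1 ≤ k
      1≤k = subst (1 ≤_) (reg u) (Adj⇒1≤degree G a)
      1≤p̄ : 1 ≤ # (not ∘ p)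
      1≤p̄ = +-cancelˡ-≤ 2 _ _ (begin
        3                       ≤⟨ *-monoʳ-≤ 3 1≤k ⟩
        3 * k                   ≤⟨ 3k≤n ⟩
        n                       ≡⟨ #-not p ⟨
        # p + # (not ∘ p)       ≡⟨ cong (_+ # (not ∘ p)) (#pair (Adj-≢ G a)) ⟩
        2 + # (not ∘ p)         ∎)
      outside : ∃ λ z → p z ≡ false
      outside = let z , e = #-positive (not ∘ p) 1≤p̄ in z , not-true e
      -- The pair has boundary 2k - 2, which is at least k by super-λ.
      2≤k : 2 ≤ k
      2≤k = +-cancelʳ-≤ k _ _ (begin
        2 + k             ≤⟨ +-monoʳ-≤ 2 (proper p (#-member p (pairˡ u v)) 1≤p̄) ⟩
        2 + cut G p       ≡⟨ cut≡ ⟩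
        k + k             ∎)
      nbr : ∀ z → p z ≡ false → ∃ λ w → p w ≡ false × Adj G z w
      nbr z _ = let w , e , b = nb-witness G (not ∘ p) z (+-cancelˡ-≤ 1 _ _ (begin
                      2                                   ≤⟨ 2≤k ⟩
                      k                                   ≡⟨ trans (nb-not G p z) (reg z) ⟨
                      nb G p z + nb G (not ∘ p) z         ≤⟨ +-monoˡ-≤ _ (triangle-free-pair G tf a z) ⟩
                      1 + nb G (not ∘ p) z                ∎))
                in w , not-true e , b

    λ′-cut : ∀ p → 2 ≤ # p → 2 ≤ # (not ∘ p) → l ≤ cut G p
    λ′-cut p 2≤p 2≤p̄
      with any? (λ u → ¬? (any? (λ v → (p u ≟ᵇ p v) ×-dec T? (adj G u v))))
    ... | no every = ≤-trans
            (proj₂ (proj₂ λ′) (cutOff G p) (cutOff-extra₁ G p inside outside λ u →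
              decidable-stable (any? (λ v → (p u ≟ᵇ p v) ×-dec T? (adj G u v))) λ none → every (u , none)))
            (≤-reflexive (size-boundary-tabulate G p))
      where
      inside : ∃ λ u → p u ≡ true
      inside = #-positive p (≤-trans (s≤s z≤n) 2≤p)
      outside : ∃ λ v → p v ≡ false
      outside = let v , e = #-positive (not ∘ p) (≤-trans (s≤s z≤n) 2≤p̄) in v , not-true e
    ... | yes (u , none) = ≤-trans l≤k+k (by-side (p u) refl)
      where
      l≤k+k : l ≤ k + k
      l≤k+k = ≤-trans (m≤m+n l 2) (≤-trans λ′-upper (≤-reflexive (cong (k +_) (+-identityʳ k))))
      by-side : ∀ b → p u ≡ b → k + k ≤ cut G p
      by-side true pu = isolated-cut G reg proper p u pu
        (λ v pv a → none (v , trans pu (sym pv) , a)) 2≤p (≤-trans (s≤s z≤n) 2≤p̄)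
      by-side false pu = ≤-trans
        (isolated-cut G reg proper (not ∘ p) u (not-false pu)
          (λ v pv a → none (v , trans pu (sym (not-true pv)) , a)) 2≤p̄
          (≤-trans (s≤s z≤n) (≤-trans 2≤p (≤-reflexive (#-cong λ v → sym (not-involutive (p v)))))))
        (≤-reflexive (cut-not G p))

    side : ∀ p → Side k n l (# p) (# (not ∘ p)) (cut G p)
    side p = record
      { total = #-not p
      ; low   = proper p
      ; high  = λ′-cut p
      ; inner = mantel G reg tf p
      ; outer = subst (λ c → 2 * (# (not ∘ p) * k) ≤ 2 * c + # (not ∘ p) * # (not ∘ p)) (cut-not G p)
                  (mantel G reg tf (not ∘ p))
      }

-- The graph G(G₀,G₁;M)

module Matched (G₀ G₁ : Graph n) (M : Permutation n n) where

  private
    G : Graph (n + n)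
    G = matchingGraph G₀ G₁ M

  left right : (Fin (n + n) → Bool) → Fin n → Bool
  left  p = p ∘ (_↑ˡ n)
  right p = p ∘ (n ↑ʳ_)

  #-halves : ∀ p → # p ≡ # (left p) + # (right p)
  #-halves p = sum-↑ n n (ι ∘ p)

  sum-matched : (q : Fin n → Bool) (x : Fin n) → sum (λ v → ι (q v ∧ ⟦ x ⟧ v)) ≡ ι (q x)
  sum-matched q x = trans
    (sum-cong-≗ λ v → trans (ι-∧ (q v) _) (*-comm (ι (q v)) _)) (sum-⟦⟧ x (ι ∘ q))

  nb-left : ∀ q u → nb G q (u ↑ˡ n) ≡ nb G₀ (left q) u + ι (right q (M ⟨$⟩ʳ u))
  nb-left q u = trans (sum-↑ n n _) (cong₂ _+_
    (sum-cong-≗ λ v → cong (λ b → ι (q (v ↑ˡ n) ∧ b))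
      (cong₂ (matchingAdj G₀ G₁ M) (splitAt-↑ˡ n u n) (splitAt-↑ˡ n v n)))
    (trans (sum-cong-≗ λ v → cong (λ b → ι (q (n ↑ʳ v) ∧ b))
      (cong₂ (matchingAdj G₀ G₁ M) (splitAt-↑ˡ n u n) (splitAt-↑ʳ n n v)))
      (sum-matched (right q) (M ⟨$⟩ʳ u))))

  matched-inverse : ∀ u v → does (M ⟨$⟩ʳ u ≟ v) ≡ ⟦ M ⟨$⟩ˡ v ⟧ u
  matched-inverse u v with M ⟨$⟩ʳ u ≟ v | M ⟨$⟩ˡ v ≟ u
  ... | yes _    | yes _    = refl
  ... | no _     | no _     = refl
  ... | yes refl | no ≢u    = contradiction (inverseˡ M) ≢u
  ... | no ≢v    | yes refl = contradiction (inverseʳ M) ≢v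

  nb-right : ∀ q v → nb G q (n ↑ʳ v) ≡ ι (left q (M ⟨$⟩ˡ v)) + nb G₁ (right q) v
  nb-right q v = trans (sum-↑ n n _) (cong₂ _+_
    (trans (sum-cong-≗ λ u → cong (λ b → ι (q (u ↑ˡ n) ∧ b))
      (trans (cong₂ (matchingAdj G₀ G₁ M) (splitAt-↑ʳ n n v) (splitAt-↑ˡ n u n)) (matched-inverse u v)))
      (sum-matched (left q) (M ⟨$⟩ˡ v)))
    (sum-cong-≗ λ w → cong (λ b → ι (q (n ↑ʳ w) ∧ b))
      (cong₂ (matchingAdj G₀ G₁ M) (splitAt-↑ʳ n n v) (splitAt-↑ʳ n n w))))

  matching-regular : ∀ {k} → Regular k G₀ → Regular k G₁ → Regular (k + 1) G
  matching-regular {k} reg₀ reg₁ = halves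
    (λ u → begin
      degree G (u ↑ˡ n)                         ≡⟨ degree≡# G (u ↑ˡ n) ⟩
      nb G (λ _ → true) (u ↑ˡ n)                ≡⟨ nb-left (λ _ → true) u ⟩
      nb G₀ (λ _ → true) u + 1                  ≡⟨ cong (_+ 1) (trans (sym (degree≡# G₀ u)) (reg₀ u)) ⟩
      k + 1                                     ∎)
    (λ v → begin
      degree G (n ↑ʳ v)                         ≡⟨ degree≡# G (n ↑ʳ v) ⟩
      nb G (λ _ → true) (n ↑ʳ v)                ≡⟨ nb-right (λ _ → true) v ⟩
      1 + nb G₁ (λ _ → true) v                  ≡⟨ cong (1 +_) (trans (sym (degree≡# G₁ v)) (reg₁ v)) ⟩
      1 + k                                     ≡⟨ +-comm 1 k ⟩
      k + 1                                     ∎)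
    where
    open ≡-Reasoning
    halves : {P : Fin (n + n) → Set} → (∀ u → P (u ↑ˡ n)) → (∀ v → P (n ↑ʳ v)) → ∀ x → P x
    halves {P} f g x with splitAt n x in eq
    ... | inj₁ u = subst P (splitAt⁻¹-↑ˡ eq) (f u)
    ... | inj₂ v = subst P (splitAt⁻¹-↑ʳ eq) (g v)

  private
    A : Fin n ⊎ Fin n → Fin n ⊎ Fin n → Set
    A x y = T (matchingAdj G₀ G₁ M x y)

    matched : ∀ {u v} → T (does (M ⟨$⟩ʳ u ≟ v)) → M ⟨$⟩ʳ u ≡ v
    matched {u} {v} t = ⟦⟧⇒≡ {u = M ⟨$⟩ʳ u} {v} (≡true t)

    matched-injective : ∀ {u v w} → T (does (M ⟨$⟩ʳ u ≟ w)) → T (does (M ⟨$⟩ʳ v ≟ w)) → u ≡ v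
    matched-injective {u} {v} {w} s t = trans (sym (inverseˡ M))
      (trans (cong (M ⟨$⟩ˡ_) (trans (matched {u} {w} s) (sym (matched {v} {w} t)))) (inverseˡ M))

    matched-functional : ∀ {u v w} → T (does (M ⟨$⟩ʳ u ≟ v)) → T (does (M ⟨$⟩ʳ u ≟ w)) → v ≡ w
    matched-functional {u} {v} {w} s t = trans (sym (matched {u} {v} s)) (matched {u} {w} t)

    -- A triangle meeting both copies has two matching edges with a common end; their other ends
    -- coincide, so the third edge would be a loop.
    no-triangle : TriangleFree G₀ → TriangleFree G₁ → ∀ x y z → A x y → A y z → ¬ A z x
    no-triangle tf₀ tf₁ (inj₁ u) (inj₁ v) (inj₁ w) a b c = tf₀ u v w a b c
    no-triangle tf₀ tf₁ (inj₂ u) (inj₂ v) (inj₂ w) a b c = tf₁ u v w a b c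
    no-triangle tf₀ tf₁ (inj₁ u) (inj₁ v) (inj₂ w) a b c = Adj-≢ G₀ a (matched-injective {u} {v} {w} c b)
    no-triangle tf₀ tf₁ (inj₁ u) (inj₂ v) (inj₁ w) a b c = Adj-≢ G₀ c (matched-injective {w} {u} {v} b a)
    no-triangle tf₀ tf₁ (inj₂ u) (inj₁ v) (inj₁ w) a b c = Adj-≢ G₀ b (matched-injective {v} {w} {u} a c)
    no-triangle tf₀ tf₁ (inj₁ u) (inj₂ v) (inj₂ w) a b c = Adj-≢ G₁ b (matched-functional {u} {v} {w} a c)
    no-triangle tf₀ tf₁ (inj₂ u) (inj₁ v) (inj₂ w) a b c = Adj-≢ G₁ c (matched-functional {v} {w} {u} b a)
    no-triangle tf₀ tf₁ (inj₂ u) (inj₂ v) (inj₁ w) a b c = Adj-≢ G₁ a (matched-functional {w} {u} {v} c b)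

  matching-triangleFree : TriangleFree G₀ → TriangleFree G₁ → TriangleFree G
  matching-triangleFree tf₀ tf₁ x y z = no-triangle tf₀ tf₁ (splitAt n x) (splitAt n y) (splitAt n z)

  -- The matching edges in the boundary of `p`, separated by the copy that holds the end in `p`.
  -- Each family bounds the excess of its half over the other.
  crossˡ crossʳ : (Fin (n + n) → Bool) → ℕ
  crossˡ p = sum (λ u → ι (left p u) * ι (not (right p (M ⟨$⟩ʳ u))))
  crossʳ p = sum (λ v → ι (right p v) * ι (not (left p (M ⟨$⟩ˡ v))))

  cut-matching : ∀ p → cut G p ≡ cut G₀ (left p) + cut G₁ (right p) + (crossˡ p + crossʳ p)
  cut-matching p = begin
    cut G p
      ≡⟨ sum-↑ n n (λ x → ι (p x) * nb G (not ∘ p) x) ⟩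
    sum (λ u → ι (left p u) * nb G (not ∘ p) (u ↑ˡ n)) + sum (λ v → ι (right p v) * nb G (not ∘ p) (n ↑ʳ v))
      ≡⟨ cong₂ _+_ leftSum rightSum ⟩
    cut G₀ (left p) + crossˡ p + (crossʳ p + cut G₁ (right p))
      ≡⟨ lemma (cut G₀ (left p)) (crossˡ p) (crossʳ p) (cut G₁ (right p)) ⟩
    cut G₀ (left p) + cut G₁ (right p) + (crossˡ p + crossʳ p) ∎
    where
    open ≡-Reasoning
    lemma : ∀ a b c d → a + b + (c + d) ≡ a + d + (b + c)
    lemma = solve-∀
    leftSum : sum (λ u → ι (left p u) * nb G (not ∘ p) (u ↑ˡ n)) ≡ cut G₀ (left p) + crossˡ p
    leftSum = trans
      (sum-cong-≗ λ u → trans (cong (ι (left p u) *_) (nb-left (not ∘ p) u)) (*-distribˡ-+ (ι (left p u)) _ _))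
      (∑-distrib-+ (λ u → ι (left p u) * nb G₀ (not ∘ left p) u) _)
    rightSum : sum (λ v → ι (right p v) * nb G (not ∘ p) (n ↑ʳ v)) ≡ crossʳ p + cut G₁ (right p)
    rightSum = trans
      (sum-cong-≗ λ v → trans (cong (ι (right p v) *_) (nb-right (not ∘ p) v)) (*-distribˡ-+ (ι (right p v)) _ _))
      (∑-distrib-+ (λ v → ι (right p v) * ι (not (left p (M ⟨$⟩ˡ v)))) _)

  private
    #-matched : (π : Permutation n n) (p q : Fin n → Bool) →
                # p ≤ # q + sum (λ u → ι (p u) * ι (not (q (π ⟨$⟩ʳ u))))
    #-matched π p q = begin
      # p                                                           ≤⟨ sum-mono (λ u → bound (p u) (q (π ⟨$⟩ʳ u))) ⟩
      sum (λ u → ι (q (π ⟨$⟩ʳ u)) + ι (p u) * ι (not (q (π ⟨$⟩ʳ u)))) ≡⟨ ∑-distrib-+ (λ u → ι (q (π ⟨$⟩ʳ u))) _ ⟩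
      sum (λ u → ι (q (π ⟨$⟩ʳ u))) + crossing                       ≡⟨ cong (_+ crossing) (sum-permute (ι ∘ q) π) ⟨
      # q + crossing                                                ∎
      where
      open ≤-Reasoning
      crossing : ℕ
      crossing = sum (λ u → ι (p u) * ι (not (q (π ⟨$⟩ʳ u))))
      bound : ∀ a b → ι a ≤ ι b + ι a * ι (not b)
      bound false _     = z≤n
      bound true  true  = ≤-refl
      bound true  false = ≤-refl

  #-left≤ : ∀ p → # (left p) ≤ # (right p) + (crossˡ p + crossʳ p)
  #-left≤ p = ≤-trans (#-matched M (left p) (right p)) (+-monoʳ-≤ (# (right p)) (m≤m+n _ _))

  #-right≤ : ∀ p → # (right p) ≤ # (left p) + (crossˡ p + crossʳ p)
  #-right≤ p = ≤-trans (#-matched (inverse M) (right p) (left p)) (+-monoʳ-≤ (# (left p)) (m≤n+m _ _))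

-- Extra edge-cuts and super-λ″

beyond : (p q : Fin n → Bool) → # q < # p → ∃ λ w → p w ≡ true × q w ≡ false
beyond p q lt with any? (λ w → (p w ≟ᵇ true) ×-dec (q w ≟ᵇ false))
... | yes found = found
... | no none = contradiction lt (≤⇒≯ (#-mono λ w pw → ≢false λ qw → none (w , pw , qw)))

⊆-# : (p q : Fin n → Bool) → (∀ w → q w ≡ true → p w ≡ true) → # p ≤ # q → ∀ w → p w ≡ q w
⊆-# p q q⊆p le w with p w in pw | q w in qw
... | true  | true  = refl
... | false | false = refl
... | false | true  = contradiction (q⊆p w qw) (λ e → true≢false e pw)
... | true  | false = contradiction (sum-tight (λ i → ι-mono (q⊆p i)) le w)
                        (λ h → contradiction (subst₂ (λ a b → ι a ≤ ι b) pw qw h) λ ())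

-- The smallest allowed order is attained or can be raised by one. This turns bounds for 3-extra
-- cuts into bounds for 2-extra and 1-extra ones, and it produces the component that `Super` asks
-- for.
grow-extra : ∀ {h} (G F : Graph n) → IsExtraEdgeCut h G F →
             (∃ λ u → # (comp (G ∖ F) u) ≡ suc h) ⊎ IsExtraEdgeCut (suc h) G F
grow-extra {h = h} G F (F⊆G , disc , large) with any? (λ u → # (comp (G ∖ F) u) ≟ℕ suc h)
... | yes found = inj₁ found
... | no none = inj₂ (F⊆G , disc , λ { C (u , isC) →
    ≤∧≢⇒< (large C (u , isC)) λ e → none (u , trans (sym (count C u isC)) (sym e)) })
  where
  count : ∀ C u → (∀ v → (v ∈ C) ⇔ Reachable (G ∖ F) u v) → ∣ C ∣ ≡ # (comp (G ∖ F) u)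
  count C u isC = trans (∣lookup∣ C) (≤-antisym
    (#-mono λ v e → comp-complete (G ∖ F) u v (Equivalence.to (isC v) (lookup⇒[]= v C e)))
    (#-mono λ v e → ∈-lookup (Equivalence.from (isC v) (comp-sound (G ∖ F) u v e))))

cut-witness : (G : Graph n) (p : Fin n → Bool) → 1 ≤ cut G p → ∃₂ λ x y → p x ≡ true × p y ≡ false × Adj G x y
cut-witness G p h with sum-positive (λ u → ι (p u) * nb G (not ∘ p) u) h
... | x , hx with p x in px
...   | true = let y , py , a = nb-witness G (not ∘ p) x (subst (1 ≤_) (*-identityˡ _) hx) in
               x , y , px , not-true py , a

connected : (G : Graph n) → (∀ p → 1 ≤ # p → 1 ≤ # (not ∘ p) → 1 ≤ cut G p) → Connected G
connected G h u v with comp G u v in e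
... | true  = comp-sound G u v e
... | false with cut-witness G (comp G u)
                   (h (comp G u) (#-member (comp G u) (comp-refl G u)) (#-member (not ∘ comp G u) {v} (not-false e)))
...   | x , y , ux , uy , a = contradiction uy (true≢false (comp-closed G u {x} {y} a ux))

-- The connected sets to be exhibited are an edge and a path on three vertices, both of them stars.
hub-connected : (G : Graph n) (p : Fin n → Bool) (b : Fin n) → p b ≡ true →
                (∀ x → p x ≡ true → x ≡ b ⊎ Adj G x b) → InducesConnected G (tabulate p)
hub-connected {n = n} G p b pb spoke u v u∈ v∈ =
  toHub u u∈ ◅◅ reverse (λ (x∈ , y∈ , a) → y∈ , x∈ , Adj-sym G a) (toHub v v∈)
  where
  b∈ : b ∈ tabulate p
  b∈ = Equivalence.from (∈-tabulate p b) pb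
  toHub : ∀ x → x ∈ tabulate p → Star (λ x y → x ∈ tabulate p × y ∈ tabulate p × Adj G x y) x b
  toHub x x∈ with spoke x (Equivalence.to (∈-tabulate p x) x∈)
  ... | inj₁ refl = ε
  ... | inj₂ a    = (x∈ , b∈ , a) ◅ ε

cutOff-reach : (G : Graph n) (p : Fin n → Bool) → InducesConnected G (tabulate p) →
               ∀ {u v} → p u ≡ true → p v ≡ true → Reachable (G ∖ cutOff G p) u v
cutOff-reach G p conn {u} {v} pu pv = gmap (λ x → x)
  (λ {x} {y} (x∈ , y∈ , a) → cutOff-keeps G p a
    (trans (Equivalence.to (∈-tabulate p x) x∈) (sym (Equivalence.to (∈-tabulate p y) y∈))))
  (conn u v (Equivalence.from (∈-tabulate p u) pu) (Equivalence.from (∈-tabulate p v) pv))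

proper-tabulate : (p : Fin n → Bool) → (∃ λ z → p z ≡ false) → tabulate p ⊂ ⊤
proper-tabulate p (z , pz) = (λ _ → ∈⊤) , z , ∈⊤ , λ m → true≢false (Equivalence.to (∈-tabulate p z) m) pz

pair-swap : (u v : Fin n) → ∀ w → pair u v w ≡ pair v u w
pair-swap u v w = ∨-comm (⟦ u ⟧ w) (⟦ v ⟧ w)

pair-⊆ : (p : Fin n → Bool) {u v : Fin n} → p u ≡ true → p v ≡ true → ∀ w → pair u v w ≡ true → p w ≡ true
pair-⊆ p {u} {v} pu pv w e = [ (λ uw → subst (λ x → p x ≡ true) (⟦⟧⇒≡ uw) pu)
                             , (λ vw → subst (λ x → p x ≡ true) (⟦⟧⇒≡ vw) pv) ]′ (∪-elim ⟦ u ⟧ ⟦ v ⟧ {w} e)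

triple : Fin n → Fin n → Fin n → Fin n → Bool
triple a b c = pair a b ∪ ⟦ c ⟧

#triple : {a b c : Fin n} → a ≢ b → pair a b c ≡ false → # (triple a b c) ≡ 3
#triple {a = a} {b} {c} a≢b c∉ = trans (#-⊎ (triple a b c) (pair a b) ⟦ c ⟧ (∪-⟦⟧ (pair a b) c∉))
  (cong₂ _+_ (#pair a≢b) (#⟦⟧ c))

-- What super-λ″ and persistence need of the matching graph. The parameter k is the degree in the
-- copies, so vertices here have degree k + 1.
record Robust (k : ℕ) (G : Graph n) : Set where
  field
    order        : 4 ≤ n
    valency      : 4 ≤ k
    regular      : Regular (k + 1) G
    triangleFree : TriangleFree G
    proper-cut   : ∀ p → 1 ≤ # p → 1 ≤ # (not ∘ p) → k + 1 ≤ cut G p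
    large-cut    : ∀ p → 4 ≤ # p → 4 ≤ # (not ∘ p) → 3 * k ≤ cut G p

module _ {k : ℕ} (G : Graph n) (robust : Robust k G) where

  open Robust robust

  -- Mantel's bound allows 9/4 edges inside, so by rounding at most two; the degree sum is 3(k + 1).
  three-cut : ∀ p → # p ≡ 3 → 3 * k ≤ cut G p + 1
  three-cut p e = ≤-pred (*-cancelˡ-< 2 _ _ (+-cancelʳ-< 6 _ _ (begin-strict
    2 * (3 * k) + 6               ≡⟨ lemma₁ k ⟩
    2 * (3 * (k + 1))             ≡⟨ cong (λ z → 2 * (z * (k + 1))) e ⟨
    2 * (# p * (k + 1))           ≤⟨ mantel G regular triangleFree p ⟩
    2 * cut G p + # p * # p       ≡⟨ cong (λ z → 2 * cut G p + z * z) e ⟩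
    2 * cut G p + 9               <⟨ ≤-reflexive (lemma₂ (cut G p)) ⟩
    2 * suc (cut G p + 1) + 6     ∎)))
    where
    open ≤-Reasoning
    lemma₁ : ∀ k → 2 * (3 * k) + 6 ≡ 2 * (3 * (k + 1))
    lemma₁ = solve-∀
    lemma₂ : ∀ c → suc (2 * c + 9) ≡ 2 * suc (c + 1) + 6
    lemma₂ = solve-∀

  extra₃-size : ∀ F → IsExtraEdgeCut 3 G F → 3 * k ≤ size F
  extra₃-size F extra = ≤-trans (large-cut (comp (G ∖ F) u) (Separates.inner s) (Separates.outer s)) (comp-cut≤size G F u)
    where
    u : Fin n
    u = inhabited {G = G ∖ F} (proj₁ (proj₂ extra))
    s : Separates 3 G F u
    s = separates {G = G} {F} extra u

  extra₂-size : ∀ F → IsExtraEdgeCut 2 G F → 3 * k ≤ size F + 1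
  extra₂-size F extra with grow-extra G F extra
  ... | inj₁ (u , three) = ≤-trans (three-cut (comp (G ∖ F) u) three) (+-monoˡ-≤ 1 (comp-cut≤size G F u))
  ... | inj₂ extra₃      = ≤-trans (extra₃-size F extra₃) (m≤m+n _ 1)

  outsider : ∀ p → # p ≤ 3 → ∃ λ z → p z ≡ false
  outsider p le = let z , e = #-positive (not ∘ p) (+-cancelˡ-≤ 3 _ _
                        (≤-trans order (≤-trans (≤-reflexive (sym (#-not p))) (+-monoˡ-≤ (# (not ∘ p)) le))))
                  in z , not-true e

  vertex : Fin n
  vertex = proj₁ (outsider (λ _ → false) (≤-trans (≤-reflexive (sum-replicate-zero n)) z≤n))

  -- A path on three vertices with centre a, the set that attains ξ₂.
  cherry : ∃₂ λ a b → ∃ λ c → Adj G a b × Adj G a c × pair a b c ≡ false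
  cherry =
    let a      = vertex
        2<     = subst (2 <_) (trans (sym (regular a)) (degree≡# G a))
                   (≤-trans (≤-trans (s≤s (s≤s (s≤s z≤n))) valency) (m≤m+n k 1))
        b , ab = #-positive (adj G a) (≤-trans (s≤s z≤n) 2<)
        c , ac , c∉ = beyond (adj G a) (pair a b) (subst (_< # (adj G a)) (sym (#pair (Adj-≢ G (fromTrue ab)))) 2<)
    in a , b , c , fromTrue ab , fromTrue ac , c∉

  robust-connected : Connected G
  robust-connected = connected G λ p i o → ≤-trans (m≤n+m 1 k) (proper-cut p i o)

  private module Cherry {a b c : Fin n} (a∼b : Adj G a b) (a∼c : Adj G a c) (c∉ : pair a b c ≡ false) where

    p : Fin n → Bool
    p = triple a b c

    #p : # p ≡ 3
    #p = #triple (Adj-≢ G a∼b) c∉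

    pa : p a ≡ true
    pa = ∪-introˡ (pair a b) ⟦ c ⟧ (pairˡ a b)
    pb : p b ≡ true
    pb = ∪-introˡ (pair a b) ⟦ c ⟧ (pairʳ a b)
    pc : p c ≡ true
    pc = ∪-introʳ (pair a b) ⟦ c ⟧ (⟦⟧-refl c)

    b≢c : b ≢ c
    b≢c e = true≢false (pairʳ a b) (trans (cong (pair a b) e) c∉)

    p-connected : InducesConnected G (tabulate p)
    p-connected = hub-connected G p a pa λ x e → spoke x (∪-elim (pair a b) ⟦ c ⟧ {x} e)
      where
      spoke : ∀ x → pair a b x ≡ true ⊎ ⟦ c ⟧ x ≡ true → x ≡ a ⊎ Adj G x a
      spoke x (inj₂ cx) = inj₂ (subst (λ y → Adj G y a) (⟦⟧⇒≡ cx) (Adj-sym G a∼c))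
      spoke x (inj₁ e) with ∪-elim ⟦ a ⟧ ⟦ b ⟧ {x} e
      ... | inj₁ ax = inj₁ (sym (⟦⟧⇒≡ ax))
      ... | inj₂ bx = inj₂ (subst (λ y → Adj G y a) (⟦⟧⇒≡ bx) (Adj-sym G a∼b))

    p-edges : 4 ≤ edges G p p
    p-edges = begin
      2 + 1 + 1
        ≤⟨ +-mono-≤ (+-mono-≤ a-inside (inside b a pa (Adj-sym G a∼b))) (inside c a pa (Adj-sym G a∼c)) ⟩
      nb G p a + nb G p b + nb G p c             ≡⟨ cong₂ _+_ (edges-pair G (Adj-≢ G a∼b) p) (edges-⟦⟧ G c p) ⟨
      edges G (pair a b) p + edges G ⟦ c ⟧ p     ≡⟨ edges-⊎ˡ G p (pair a b) ⟦ c ⟧ p (∪-⟦⟧ (pair a b) c∉) ⟨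
      edges G p p                                ∎
      where
      open ≤-Reasoning
      inside : ∀ x y → p y ≡ true → Adj G x y → 1 ≤ nb G p x
      inside x y py x∼y = #-member (λ v → p v ∧ adj G x v) {y} (cong₂ _∧_ py (≡true x∼y))
      a-inside : 2 ≤ nb G p a
      a-inside = subst (_≤ nb G p a) (#pair b≢c) (#-mono
        (pair-⊆ (λ v → p v ∧ adj G a v) (cong₂ _∧_ pb (≡true a∼b)) (cong₂ _∧_ pc (≡true a∼c))))

    m : ℕ
    m = cut G p

    -- The two edges of the path keep at least 4 of the degree sum 3(k + 1) inside; the reverse
    -- inequality is `three-cut`.
    m+1 : m + 1 ≡ 3 * k
    m+1 = ≤-antisym (+-cancelˡ-≤ 3 _ _ (begin
      3 + (m + 1)               ≡⟨ lemma m ⟩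
      4 + m                     ≤⟨ +-monoˡ-≤ m p-edges ⟩
      edges G p p + m           ≡⟨ regular-edges G regular p ⟩
      # p * (k + 1)             ≡⟨ cong (_* (k + 1)) #p ⟩
      3 * (k + 1)               ≡⟨ lemma′ k ⟩
      3 + 3 * k                 ∎)) (three-cut p #p)
      where
      open ≤-Reasoning
      lemma : ∀ m → 3 + (m + 1) ≡ 4 + m
      lemma = solve-∀
      lemma′ : ∀ k → 3 * (k + 1) ≡ 3 + 3 * k
      lemma′ = solve-∀

    p-extra : IsExtraEdgeCut 2 G (cutOff G p)
    p-extra = cutOff-extra G p (a , pa) (outsider p (≤-reflexive #p)) large
      where
      large : ∀ u → ∃ λ q → 2 < # q × (∀ v → q v ≡ true → Reachable (G ∖ cutOff G p) u v)
      large u with p u in pu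
      ... | true  = p , ≤-reflexive (sym #p) , λ v pv → cutOff-reach G p p-connected pu pv
      -- The vertex u has at most one neighbour on the edge ab and at most one more at c, so at
      -- least k - 1 ≥ 3 outside the path, all still joined to u.
      ... | false = outer , +-cancelˡ-≤ 2 _ _ enough , λ v e →
              cutOff-keeps G p (fromTrue (proj₂ (∧-true {not (p v)} e)))
                (trans pu (sym (not-true (proj₁ (∧-true e))))) ◅ ε
        where
        open ≤-Reasoning
        outer : Fin n → Bool
        outer v = not (p v) ∧ adj G u v
        ι≤1 : ∀ b → ι b ≤ 1
        ι≤1 true  = ≤-refl
        ι≤1 false = z≤n
        nb≤2 : nb G p u ≤ 2
        nb≤2 = begin
          nb G p u                              ≡⟨ nb-⊎ G p (pair a b) ⟦ c ⟧ (∪-⟦⟧ (pair a b) c∉) u ⟩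
          nb G (pair a b) u + nb G ⟦ c ⟧ u      ≡⟨ cong (nb G (pair a b) u +_) (nb-⟦⟧ G c u) ⟩
          nb G (pair a b) u + ι (adj G u c)     ≤⟨ +-mono-≤ (triangle-free-pair G triangleFree a∼b u) (ι≤1 (adj G u c)) ⟩
          2                                     ∎
        enough : 2 + 3 ≤ 2 + # outer
        enough = begin
          4 + 1                                 ≤⟨ +-monoˡ-≤ 1 valency ⟩
          k + 1                                 ≡⟨ trans (nb-not G p u) (regular u) ⟨
          nb G p u + nb G (not ∘ p) u           ≤⟨ +-monoˡ-≤ (# outer) nb≤2 ⟩
          2 + # outer                           ∎

    m≤ : ∀ {x} → 3 * k ≤ x + 1 → m ≤ x
    m≤ {x} h = +-cancelʳ-≤ 1 m x (≤-trans (≤-reflexive m+1) h)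

    cherry-super : Super 2 G
    cherry-super =
        ( m
        , ( robust-connected
          , (cutOff G p , p-extra , size-boundary-tabulate G p)
          , λ F extra → m≤ (extra₂-size F extra))
        , ( tabulate p
          , (proper-tabulate p (outsider p (≤-reflexive #p)) , trans (∣tabulate∣ p) #p , p-connected)
          , size-boundary-tabulate G p)
        , λ { X (_ , three , _) → subst (m ≤_) (sym (size-boundary G X))
                (m≤ (three-cut (lookup X) (trans (sym (∣lookup∣ X)) three))) })
      , isolates
      where
      isolates : ∀ F → IsMinExtraEdgeCut 2 G F → ∃ λ C → IsComponent (G ∖ F) C × ∣ C ∣ ≡ 3
      isolates F (extra , _ , _ , minimal) with grow-extra G F extra
      ... | inj₁ (u , three) = tabulate (comp (G ∖ F) u) , comp-isComponent (G ∖ F) u , trans (∣tabulate∣ (comp (G ∖ F) u)) three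
      -- Without a component of order 3 the cut has at least 3k = m + 1 edges, one too many.
      ... | inj₂ extra₃ = contradiction (begin
        m + 1                   ≡⟨ m+1 ⟩
        3 * k                   ≤⟨ extra₃-size F extra₃ ⟩
        size F                  ≤⟨ minimal (cutOff G p) p-extra ⟩
        size (cutOff G p)       ≡⟨ size-boundary-tabulate G p ⟩
        m                       ∎) (<⇒≱ (m<m+n m (s≤s z≤n)))
        where open ≤-Reasoning

  super-λ″ : Super 2 G
  super-λ″ = let _ , _ , _ , a∼b , a∼c , c∉ = cherry in Cherry.cherry-super a∼b a∼c c∉

-- Persistence

two-elements : (p : Fin n → Bool) {x y : Fin n} → p x ≡ true → p y ≡ true → x ≢ y → # p ≡ 2 →
               ∀ w → p w ≡ pair x y w
two-elements p {x} {y} px py x≢y two =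
  ⊆-# p (pair x y) (pair-⊆ p px py) (≤-reflexive (trans two (sym (#pair x≢y))))

module Deleted {k : ℕ} (G H F : Graph n) (robust : Robust k G) (dec : G ≅ H ⊎ᴱ F) (few : size F ≤ k) where

  open Robust robust

  private
    f : Fin n → ℕ
    f = degree F

    1≤k : 1 ≤ k
    1≤k = ≤-trans (s≤s z≤n) valency

  H-cut : ∀ p → 1 ≤ # p → 1 ≤ # (not ∘ p) → 1 ≤ cut H p
  H-cut p i o = +-cancelʳ-≤ k _ _ (begin
    1 + k                     ≡⟨ +-comm 1 k ⟩
    k + 1                     ≤⟨ proper-cut p i o ⟩
    cut G p                   ≡⟨ cut-decompose G H F dec p ⟩
    cut H p + cut F p         ≤⟨ +-monoʳ-≤ (cut H p) (≤-trans (cut-self≤size F p) few) ⟩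
    cut H p + k               ∎)
    where open ≤-Reasoning

  H-connected : Connected H
  H-connected = connected H H-cut

  H-neighbour : ∀ x → ∃ λ y → Adj H x y
  H-neighbour x = let
      z , x≢z = outsider G robust ⟦ x ⟧ (≤-trans (≤-reflexive (#⟦⟧ x)) (s≤s z≤n))
      y , _ , a = nb-witness H (not ∘ ⟦ x ⟧) x (subst (1 ≤_) (edges-⟦⟧ H x (not ∘ ⟦ x ⟧))
                    (H-cut ⟦ x ⟧ (≤-reflexive (sym (#⟦⟧ x))) (#-member (not ∘ ⟦ x ⟧) (not-false x≢z))))
    in y , a

  H-edge : ∀ {x y} → Adj H x y → cut H (pair x y) + (f x + f y) ≡ 2 * k
  H-edge {x} {y} a = +-cancelˡ-≡ 2 _ _ (begin
    2 + (cut H (pair x y) + (f x + f y))          ≡⟨⟩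
    2 + cut H (pair x y) + (f x + f y)            ≡⟨ cong (_+ (f x + f y)) (cut-adjacent H a) ⟩
    degree H x + degree H y + (f x + f y)         ≡⟨ lemma (degree H x) (degree H y) (f x) (f y) ⟩
    degree H x + f x + (degree H y + f y)         ≡⟨ cong₂ _+_ (degree-decompose G H F dec x) (degree-decompose G H F dec y) ⟨
    degree G x + degree G y                       ≡⟨ cong₂ _+_ (regular x) (regular y) ⟩
    k + 1 + (k + 1)                               ≡⟨ lemma′ k ⟩
    2 + 2 * k                                     ∎)
    where
    open ≡-Reasoning
    lemma : ∀ a b c d → a + b + (c + d) ≡ a + c + (b + d)
    lemma = solve-∀
    lemma′ : ∀ k → k + 1 + (k + 1) ≡ 2 + 2 * k
    lemma′ = solve-∀

  -- A vertex z hanging at u after the deletion has lost k edges, and by minimality of uv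
  -- so has v; since z and v are not adjacent, more than k edges were deleted.
  no-pendant : ∀ {u v z} → Adj H u v → Adj H z u → z ≢ v → k ≤ f z → ¬ f z + f u ≤ f u + f v
  no-pendant {u} {v} {z} uv zu z≢v k≤fz le = <⇒≱ (m<m+n k 1≤k) (begin
    k + k                     ≤⟨ +-mono-≤ k≤fz (≤-trans k≤fz fz≤fv) ⟩
    f z + f v                 ≡⟨ cut-nonadjacent F z≢v z≁v ⟨
    cut F (pair z v)          ≤⟨ cut-self≤size F (pair z v) ⟩
    size F                    ≤⟨ few ⟩
    k                         ∎)
    where
    open ≤-Reasoning
    fz≤fv : f z ≤ f v
    fz≤fv = +-cancelʳ-≤ (f u) _ _ (≤-trans le (≤-reflexive (+-comm (f u) (f v))))
    z≁v : ¬ Adj F z v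
    z≁v zv = triangleFree z u v (Adjˡ G H F dec zu) (Adjˡ G H F dec uv) (Adj-sym G (Adjʳ G H F dec zv))

  module MinimalEdge {u v : Fin n} (uv : Adj H u v)
                     (minimal : ∀ {x y} → Adj H x y → cut H (pair u v) ≤ cut H (pair x y)) where

    private
      p : Fin n → Bool
      p = pair u v

      #p : # p ≡ 2
      #p = #pair (Adj-≢ H uv)

      m : ℕ
      m = cut H p

    -- The source of the strict inequalities below: a deleted edge incident with an edge of `H`
    -- forces m < 2k.
    m-bound : ∀ {x y} → Adj H x y → m + (f x + f y) ≤ 2 * k
    m-bound a = ≤-trans (+-monoˡ-≤ _ (minimal a)) (≤-reflexive (H-edge a))

    deleted-max : ∀ {x y} → Adj H x y → f x + f y ≤ f u + f v
    deleted-max {x} {y} a = +-cancelˡ-≤ m _ _ (≤-trans (m-bound a) (≤-reflexive (sym (H-edge uv))))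

    outside : ∃ λ z → p z ≡ false
    outside = outsider G robust p (≤-trans (≤-reflexive #p) (s≤s (s≤s z≤n)))

    -- If all H-neighbours of z lie in {u, v}, there is only one, as G has no triangle. Then z has
    -- lost k of its k + 1 edges, and `no-pendant` contradicts the choice of uv.
    outer-neighbour : ∀ z → p z ≡ false → ∃ λ w → p w ≡ false × Adj H z w
    outer-neighbour z pz with any? (λ w → (p w ≟ᵇ false) ×-dec T? (adj H z w))
    ... | yes found = found
    ... | no none with H-neighbour z
    ...   | t , zt = contradiction (deleted-max zt) (at t zt (≢false λ pt → none (t , pt , zt)))
      where
      k≤fz : k ≤ f z
      k≤fz = +-cancelˡ-≤ 1 _ _ (begin
        1 + k                                       ≡⟨ trans (+-comm 1 k) (sym (regular z)) ⟩
        degree G z                                  ≡⟨ degree-decompose G H F dec z ⟩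
        degree H z + f z                            ≡⟨ cong (_+ f z) (nb-not H p z) ⟨
        nb H p z + nb H (not ∘ p) z + f z           ≤⟨ +-monoˡ-≤ (f z) (+-mono-≤ inner≤1 outer≤0) ⟩
        1 + f z                                     ∎)
        where
        open ≤-Reasoning
        inner≤1 : nb H p z ≤ 1
        inner≤1 = ≤-trans (≤-trans (m≤m+n _ _) (≤-reflexive (sym (nb-decompose G H F dec p z))))
                          (triangle-free-pair G triangleFree (Adjˡ G H F dec uv) z)
        outer≤0 : nb H (not ∘ p) z ≤ 0
        outer≤0 = ≮⇒≥ λ h → let w , e , a = nb-witness H (not ∘ p) z h in none (w , not-true e , a)
      at : ∀ t → Adj H z t → p t ≡ true → ¬ f z + f t ≤ f u + f v
      at t zt pt with ∪-elim ⟦ u ⟧ ⟦ v ⟧ {t} pt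
      ... | inj₁ ut with refl ← ⟦⟧⇒≡ {u = u} {t} ut =
        no-pendant uv zt (λ { refl → true≢false (pairʳ u v) pz }) k≤fz
      ... | inj₂ vt with refl ← ⟦⟧⇒≡ {u = v} {t} vt = λ le →
        no-pendant (Adj-sym H uv) zt (λ { refl → true≢false (pairˡ u v) pz }) k≤fz
          (≤-trans le (≤-reflexive (+-comm (f u) (f v))))

    m-extra : IsExtraEdgeCut 1 H (cutOff H p)
    m-extra = pair-extra H uv outside outer-neighbour

    two-cut : ∀ q {x y} → q x ≡ true → q y ≡ true → Adj H x y → # q ≡ 2 → m ≤ cut H q
    two-cut q qx qy a two = ≤-trans (minimal a)
      (≤-reflexive (sym (cut-cong H (two-elements q qx qy (Adj-≢ H a) two))))

    -- In a path s′ s t of H both edges witness 2k − m, so at most one deleted edge is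
    -- incident with each of them.
    path-cut : ∀ q {s s′ t} → # q ≡ 3 → q s ≡ true → q s′ ≡ true → q t ≡ true →
               pair s s′ t ≡ false → Adj H s s′ → Adj H s t → m < cut H q
    path-cut q {s} {s′} {t} three qs qs′ qt t∉ ss′ st = ≰⇒> λ S≤m → <⇒≱ valency (≤3 S≤m)
      where
      open ≤-Reasoning
      S c : ℕ
      S = cut H q
      c = cut F q
      total : 3 * k ≤ S + c + 1
      total = ≤-trans (three-cut G robust q three) (≤-reflexive (cong (_+ 1) (cut-decompose G H F dec q)))
      c≤k : c ≤ k
      c≤k = ≤-trans (cut-self≤size F q) few
      2k≤ : 2 * k ≤ S + 1
      2k≤ = +-cancelˡ-≤ k _ _ (begin
        k + 2 * k       ≤⟨ total ⟩
        S + c + 1       ≤⟨ +-monoˡ-≤ 1 (+-monoʳ-≤ S c≤k) ⟩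
        S + k + 1       ≡⟨ lemma S k ⟩
        k + (S + 1)     ∎)
        where
        lemma : ∀ S k → S + k + 1 ≡ k + (S + 1)
        lemma = solve-∀
      one : S ≤ m → ∀ {x} → Adj H s x → f s + f x ≤ 1
      one S≤m a = +-cancelˡ-≤ S _ _ (≤-trans (+-monoˡ-≤ _ S≤m) (≤-trans (m-bound a) 2k≤))
      q-split : ∀ w → q w ≡ triple s s′ t w
      q-split = ⊆-# q (triple s s′ t) sub (≤-reflexive (trans three (sym (#triple (Adj-≢ H ss′) t∉))))
        where
        sub : ∀ w → triple s s′ t w ≡ true → q w ≡ true
        sub w e = [ pair-⊆ q qs qs′ w , (λ tw → subst (λ x → q x ≡ true) (⟦⟧⇒≡ tw) qt) ]′
                  (∪-elim (pair s s′) ⟦ t ⟧ {w} e)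
      c≤ : c ≤ f s + f s′ + f t
      c≤ = begin
        c                                                   ≡⟨ cut-cong F q-split ⟩
        cut F (triple s s′ t)
          ≡⟨ edges-⊎ˡ F (triple s s′ t) (pair s s′) ⟦ t ⟧ r (∪-⟦⟧ (pair s s′) t∉) ⟩
        edges F (pair s s′) r + edges F ⟦ t ⟧ r             ≡⟨ cong₂ _+_ (edges-pair F (Adj-≢ H ss′) r) (edges-⟦⟧ F t r) ⟩
        nb F r s + nb F r s′ + nb F r t
          ≤⟨ +-mono-≤ (+-mono-≤ (nb≤degree F r s) (nb≤degree F r s′)) (nb≤degree F r t) ⟩
        f s + f s′ + f t                                    ∎
        where
        r : Fin n → Bool
        r = not ∘ triple s s′ t
      c≤2 : S ≤ m → c ≤ 2
      c≤2 S≤m = ≤-trans c≤ (+-mono-≤ (one S≤m ss′) (≤-trans (m≤n+m (f t) (f s)) (one S≤m st)))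
      ≤3 : S ≤ m → k ≤ 3
      -- With at most two deleted edges in the boundary, S ≤ m ≤ 2k would give 3k ≤ 2k + 3, against
      -- k ≥ 4.
      ≤3 S≤m = +-cancelˡ-≤ (2 * k) _ _ (begin
        2 * k + k                       ≡⟨ +-comm (2 * k) k ⟩
        3 * k                           ≤⟨ total ⟩
        S + c + 1
          ≤⟨ +-monoˡ-≤ 1 (+-mono-≤ (≤-trans S≤m (≤-trans (m≤m+n m _) (m-bound ss′))) (c≤2 S≤m)) ⟩
        2 * k + 2 + 1                   ≡⟨ +-assoc (2 * k) 2 1 ⟩
        2 * k + 3                       ∎)

    -- At most k of at least 3k boundary edges are deleted, so 2k ≥ m remain. For strictness, either
    -- no deleted edge crosses, or one with end x does and an H-edge at x shows m < 2k.
    large-H-cut : ∀ q → 4 ≤ # q → 4 ≤ # (not ∘ q) → m < cut H q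
    large-H-cut q four four′ with large-cut q four four′ | 1 ≤? cut F q
    ... | big | no none = begin-strict
      m                         ≤⟨ ≤-trans (m≤m+n m _) (m-bound uv) ⟩
      2 * k                     <⟨ m<n+m (2 * k) 1≤k ⟩
      3 * k                     ≤⟨ big ⟩
      cut G q                   ≡⟨ cut-decompose G H F dec q ⟩
      cut H q + cut F q         ≤⟨ +-monoʳ-≤ (cut H q) (≤-pred (≰⇒> none)) ⟩
      cut H q + 0               ≡⟨ +-identityʳ _ ⟩
      cut H q                   ∎
      where open ≤-Reasoning
    ... | big | yes some with cut-witness F q some
    ...   | x , y , _ , _ , xy = let w , xw = H-neighbour x in +-cancelʳ-≤ k _ _ (begin
      suc m + k                       ≡⟨ cong (_+ k) (+-comm 1 m) ⟩
      m + 1 + k                       ≤⟨ +-monoˡ-≤ k (+-monoʳ-≤ m (≤-trans (Adj⇒1≤degree F xy) (m≤m+n (f x) (f w)))) ⟩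
      m + (f x + f w) + k             ≤⟨ +-monoˡ-≤ k (m-bound xw) ⟩
      2 * k + k                       ≡⟨ +-comm (2 * k) k ⟩
      3 * k                           ≤⟨ big ⟩
      cut G q                         ≡⟨ cut-decompose G H F dec q ⟩
      cut H q + cut F q               ≤⟨ +-monoʳ-≤ (cut H q) (≤-trans (cut-self≤size F q) few) ⟩
      cut H q + k                     ∎)
      where open ≤-Reasoning

    module _ (F′ : Graph n) (x : Fin n) where

      private
        H′ : Graph n
        H′ = H ∖ F′

        q : Fin n → Bool
        q = comp H′ x

        qx : q x ≡ true
        qx = comp-refl H′ x

        H′⇒H : ∀ {a b} → Adj H′ a b → Adj H a b
        H′⇒H {a} {b} e = fromTrue (proj₁ (∧-true {adj H a b} (≡true e)))

        first-step : 2 ≤ # q → ∃ λ y → q y ≡ true × Adj H x y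
        first-step two = let
            w , qw , x≢w = beyond q ⟦ x ⟧ (subst (_< # q) (sym (#⟦⟧ x)) two)
            s , y , xs , _ , sy = exit ⟦ x ⟧ (comp-sound H′ x w qw) (⟦⟧-refl x) x≢w
            xy = subst (λ z → Adj H′ z y) (sym (⟦⟧⇒≡ xs)) sy
          in y , comp-closed H′ x {x} {y} xy qx , H′⇒H xy

      component₂-cut : # q ≡ 2 → m ≤ cut H q
      component₂-cut two = let y , qy , xy = first-step (≤-reflexive (sym two)) in two-cut q qx qy xy two

      -- A component of order 3 contains a path: an edge at x, then an edge leaving this pair from
      -- one of its ends, which becomes the centre.
      component₃-cut : # q ≡ 3 → m < cut H q
      component₃-cut three with first-step (≤-trans (s≤s (s≤s z≤n)) (≤-reflexive (sym three)))
      ... | y , qy , xy with beyond q (pair x y) (≤-reflexive (trans (cong suc (#pair (Adj-≢ H xy))) (sym three)))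
      ...   | w , qw , w∉ with exit (pair x y) (comp-sound H′ x w qw) (pairˡ x y) w∉
      ...     | s , t , s∈ , t∉ , st with ∪-elim ⟦ x ⟧ ⟦ y ⟧ {s} s∈
      ...       | inj₁ xs with refl ← ⟦⟧⇒≡ {u = x} {s} xs =
        path-cut q three qx qy (comp-closed H′ x {s} {t} st qx) t∉ xy (H′⇒H st)
      ...       | inj₂ ys with refl ← ⟦⟧⇒≡ {u = y} {s} ys =
        path-cut q three qy qx (comp-closed H′ x {s} {t} st qy) (trans (pair-swap s x t) t∉) (Adj-sym H xy) (H′⇒H st)

    extra₂-size-H : ∀ F′ → IsExtraEdgeCut 2 H F′ → m < size F′
    extra₂-size-H F′ extra with grow-extra H F′ extra
    ... | inj₁ (x , three) = ≤-trans (component₃-cut F′ x three) (comp-cut≤size H F′ x)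
    ... | inj₂ extra₃ = ≤-trans (large-H-cut (comp (H ∖ F′) x) (Separates.inner s) (Separates.outer s)) (comp-cut≤size H F′ x)
      where
      x : Fin n
      x = inhabited {G = H ∖ F′} (proj₁ (proj₂ extra₃))
      s : Separates 3 H F′ x
      s = separates {G = H} {F′} extra₃ x

    extra₁-size-H : ∀ F′ → IsExtraEdgeCut 1 H F′ → m ≤ size F′
    extra₁-size-H F′ extra with grow-extra H F′ extra
    ... | inj₁ (x , two) = ≤-trans (component₂-cut F′ x two) (comp-cut≤size H F′ x)
    ... | inj₂ extra₂ = <⇒≤ (extra₂-size-H F′ extra₂)

    minimal-super : Super 1 H
    minimal-super =
        ( m
        , ( H-connected
          , (cutOff H p , m-extra , size-boundary-tabulate H p)
          , extra₁-size-H)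
        , ( tabulate p
          , (proper-tabulate p outside , trans (∣tabulate∣ p) #p , p-connected)
          , size-boundary-tabulate H p)
        , λ { X (_ , two , conn) → subst (m ≤_) (sym (size-boundary H X)) (lower X (trans (sym (∣lookup∣ X)) two) conn) })
      , isolates
      where
      p-connected : InducesConnected H (tabulate p)
      p-connected = hub-connected H p u (pairˡ u v) λ x e →
        [ (λ ux → inj₁ (sym (⟦⟧⇒≡ ux))) , (λ vx → inj₂ (subst (λ y → Adj H y u) (⟦⟧⇒≡ vx) (Adj-sym H uv))) ]′
        (∪-elim ⟦ u ⟧ ⟦ v ⟧ {x} e)
      lower : ∀ X → # (lookup X) ≡ 2 → InducesConnected H X → m ≤ cut H (lookup X)
      lower X two conn = let
          x , Xx = #-positive (lookup X) (≤-trans (s≤s z≤n) (≤-reflexive (sym two)))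
          w , Xw , x≢w = beyond (lookup X) ⟦ x ⟧ (≤-reflexive (trans (cong suc (#⟦⟧ x)) (sym two)))
          s , y , _ , _ , s∈ , y∈ , sy = exit ⟦ x ⟧ (conn x w (lookup⇒[]= x X Xx) (lookup⇒[]= w X Xw)) (⟦⟧-refl x) x≢w
        in two-cut (lookup X) (∈-lookup s∈) (∈-lookup y∈) sy two
      isolates : ∀ F′ → IsMinExtraEdgeCut 1 H F′ → ∃ λ C → IsComponent (H ∖ F′) C × ∣ C ∣ ≡ 2
      isolates F′ (extra , _ , _ , least-size) with grow-extra H F′ extra
      ... | inj₁ (x , two) =
        tabulate (comp (H ∖ F′) x) , comp-isComponent (H ∖ F′) x , trans (∣tabulate∣ (comp (H ∖ F′) x)) two
      ... | inj₂ extra₂ = contradiction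
        (≤-trans (extra₂-size-H F′ extra₂)
          (≤-trans (least-size (cutOff H p) m-extra) (≤-reflexive (size-boundary-tabulate H p)))) (n≮n m)

  deleted-super : Super 1 H
  deleted-super = let (u , v) , uv , minimal = shortest in
      MinimalEdge.minimal-super uv (λ {x} {y} → minimal (x , y))
    where
    weight : Fin n × Fin n → ℕ
    weight (x , y) = cut H (pair x y)
    Edge : Fin n × Fin n → Set
    Edge (x , y) = Adj H x y
    step : ∀ e → (∃ λ e′ → Edge e′ × weight e′ < weight e) ⊎ (∀ e′ → Edge e′ → weight e ≤ weight e′)
    step e with any? (λ x → any? (λ y → T? (adj H x y) ×-dec (weight (x , y) <?ℕ weight e)))
    ... | yes (x , y , a , lt) = inj₁ ((x , y) , a , lt)
    ... | no none = inj₂ λ (x , y) a → ≮⇒≥ λ lt → none (x , y , a , lt)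
    some : ∃ Edge
    some = let x = vertex G robust
               y , a = H-neighbour x
           in (x , y) , a
    shortest : ∃ λ e → Edge e × (∀ e′ → Edge e′ → weight e ≤ weight e′)
    shortest = least weight step some

persistence : ∀ {k} (G : Graph n) → Robust k G → IsPersistence G k
persistence {n = n} {k} G robust =
    Deleted.deleted-super G G empty robust (λ u v → sym (+-identityʳ _)) empty-size
  , (λ F F⊆G few → Deleted.deleted-super G (G ∖ F) F robust (∖-decomposes G F F⊆G) few)
  , upper
  where
  empty : Graph n
  empty = record { adj = λ _ _ → false ; adj-sym = λ _ _ → refl ; adj-irr = λ _ → refl }
  empty-size : size empty ≤ k
  empty-size = ≤-trans (≤-reflexive (trans (size≡sum empty)
    (sum-zero (λ u → # (λ (v : Fin n) → does (u <? v) ∧ false)) λ u → sum-zero (λ (v : Fin n) → ι (does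
        (u <? v) ∧ false)) λ v → cong ι (∧-zeroʳ (does (u <? v)))))) z≤n
    where
    sum-zero : (g : Fin n → ℕ) → (∀ i → g i ≡ 0) → sum g ≡ 0
    sum-zero g h = trans (sum-cong-≗ h) (sum-replicate-zero n)
  upper : ∀ m → Persists G m → m ≤ k
  -- The k + 1 edges at one vertex would be a permitted deletion, but they disconnect the graph
  -- while super-λ′ includes connectedness.
  upper m persists = ≮⇒≥ λ k<m →
    let u         = vertex G robust
        z , u≢z   = outsider G robust ⟦ u ⟧ (≤-trans (≤-reflexive (#⟦⟧ u)) (s≤s z≤n))
        F⊆G       = λ x y e → fromTrue (proj₁ (∧-true (≡true e)))
        sized     = ≤-trans (≤-reflexive (trans (size-boundary-tabulate G ⟦ u ⟧)
                      (trans (cut-⟦⟧ G u) (trans (Robust.regular robust u) (+-comm k 1))))) k<m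
        (_ , (conn , _) , _) , _ = persists (cutOff G ⟦ u ⟧) F⊆G sized
    in true≢false (closed-star (G ∖ cutOff G ⟦ u ⟧) ⟦ u ⟧ (λ {x} {y} → cutOff-closed G ⟦ u ⟧ {x} {y}) (conn u z) (⟦⟧-refl u)) u≢z

-- From the two copies to the matching graph

matching-robust : ∀ {k l₀ l₁} {G₀ G₁ : Graph n} →
  TriangleFree G₀ → Regular k G₀ → Super 0 G₀ → TriangleFree G₁ → Regular k G₁ → Super 0 G₁ →
  IsExtraEdgeConnectivity 1 G₀ l₀ → IsExtraEdgeConnectivity 1 G₁ l₁ → (M : Permutation n n) →
  3 * k ≤ n → 3 * k ≤ l₀ + l₁ → Robust k (matchingGraph G₀ G₁ M)
matching-robust {n = n} {k} {l₀} {l₁} {G₀} {G₁} tf₀ reg₀ super₀ tf₁ reg₁ super₁ λ₀ λ₁ M 3k≤n 3k≤l = record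
  { order        = ≤-trans (≤-trans 4≤k (≤-trans (m≤n*m k 3) 3k≤n)) (m≤m+n n n)
  ; valency      = 4≤k
  ; regular      = matching-regular reg₀ reg₁
  ; triangleFree = matching-triangleFree tf₀ tf₁
  ; proper-cut   = λ p i o → subst (k + 1 ≤_) (sym (cut-matching p))
      (numeric-proper 4≤k 3k≤n 3k≤l k<l₀ k<l₁ (side₀ (left p)) (side₁ (right p)) (#-left≤ p) (#-right≤ p)
        (subst (1 ≤_) (#-halves p) i) (subst (1 ≤_) (#-halves (not ∘ p)) o))
  ; large-cut    = λ p i o → subst (3 * k ≤_) (sym (cut-matching p))
      (numeric-core 4≤k 3k≤n 3k≤l k<l₀ k<l₁ (side₀ (left p)) (side₁ (right p)) (#-left≤ p) (#-right≤ p)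
        (subst (4 ≤_) (#-halves p) i) (subst (4 ≤_) (#-halves (not ∘ p)) o))
  }
  where
  open Matched G₀ G₁ M
  open ≤-Reasoning
  upper₀ : l₀ + 2 ≤ 2 * k
  upper₀ = λ′-upper G₀ tf₀ reg₀ 3k≤n super₀ λ₀
  upper₁ : l₁ + 2 ≤ 2 * k
  upper₁ = λ′-upper G₁ tf₁ reg₁ 3k≤n super₁ λ₁
  side₀ : ∀ p → Side k n l₀ (# p) (# (not ∘ p)) (cut G₀ p)
  side₀ = side G₀ tf₀ reg₀ 3k≤n super₀ λ₀
  side₁ : ∀ p → Side k n l₁ (# p) (# (not ∘ p)) (cut G₁ p)
  side₁ = side G₁ tf₁ reg₁ 3k≤n super₁ λ₁
  -- From 3k ≤ λ′₀ + λ′₁ ≤ 2(2k - 2).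
  4≤k : 4 ≤ k
  4≤k = +-cancelˡ-≤ (3 * k) _ _ (begin
    3 * k + 4                 ≤⟨ +-monoˡ-≤ 4 3k≤l ⟩
    l₀ + l₁ + 4               ≡⟨ lemma l₀ l₁ ⟩
    l₀ + 2 + (l₁ + 2)         ≤⟨ +-mono-≤ upper₀ upper₁ ⟩
    2 * k + 2 * k             ≡⟨ lemma′ k ⟩
    3 * k + k                 ∎)
    where
    lemma : ∀ x y → x + y + 4 ≡ x + 2 + (y + 2)
    lemma = solve-∀
    lemma′ : ∀ k → 2 * k + 2 * k ≡ 3 * k + k
    lemma′ = solve-∀
  -- One copy supplies at most 2k - 2 of the required 3k, so the other supplies at least k + 2.
  above : ∀ {x y} → 3 * k ≤ x + y → y + 2 ≤ 2 * k → k + 2 ≤ x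
  above {x} {y} total upper = +-cancelʳ-≤ (2 * k) _ _ (begin
    k + 2 + 2 * k             ≡⟨ lemma k ⟩
    3 * k + 2                 ≤⟨ +-monoˡ-≤ 2 total ⟩
    x + y + 2                 ≡⟨ +-assoc x y 2 ⟩
    x + (y + 2)               ≤⟨ +-monoʳ-≤ x upper ⟩
    x + 2 * k                 ∎)
    where
    lemma : ∀ k → k + 2 + 2 * k ≡ 3 * k + 2
    lemma = solve-∀
  k<l₀ : k + 2 ≤ l₀
  k<l₀ = above 3k≤l upper₁
  k<l₁ : k + 2 ≤ l₁
  k<l₁ = above (subst (3 * k ≤_) (+-comm l₀ l₁) 3k≤l) upper₀

theorem4p3 : ∀ (n k : ℕ) (G₀ G₁ : Graph n) →
    TriangleFree G₀ → Regular k G₀ → Super 0 G₀ →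
    TriangleFree G₁ → Regular k G₁ → Super 0 G₁ →
    ∀ (λ′₀ λ′₁ : ℕ) →
    IsExtraEdgeConnectivity 1 G₀ λ′₀ →
    IsExtraEdgeConnectivity 1 G₁ λ′₁ →
    ∀ (M : Permutation n n) →
    3 * k < n ⊓ (λ′₀ + λ′₁) + 1 →
    Super 2 (matchingGraph G₀ G₁ M) × IsPersistence (matchingGraph G₀ G₁ M) k
theorem4p3 n k G₀ G₁ tf₀ reg₀ super₀ tf₁ reg₁ super₁ λ′₀ λ′₁ conn₀ conn₁ M 3k< =
  super-λ″ (matchingGraph G₀ G₁ M) robust , persistence (matchingGraph G₀ G₁ M) robust
  where
  -- Adding 1 on the right expresses min > 3k - 1 without truncated subtraction, so the hypothesis
  -- amounts to 3k ≤ min.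
  3k≤ : 3 * k ≤ n ⊓ (λ′₀ + λ′₁)
  3k≤ = ≤-pred (≤-trans 3k< (≤-reflexive (+-comm _ 1)))
  robust : Robust k (matchingGraph G₀ G₁ M)
  robust = matching-robust tf₀ reg₀ super₀ tf₁ reg₁ super₁ conn₀ conn₁ M
    (m≤n⊓o⇒m≤n n (λ′₀ + λ′₁) 3k≤) (m≤n⊓o⇒m≤o n (λ′₀ + λ′₁) 3k≤)
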